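{- Let $\{T_{ij}\}_{0\le i<j\le n}$, $n\ge2$, be a tableau diagram for rank conditions $r$, and let $(W_1,\dots,W_n)$ be tableaux such that each $W_i$ contains $T_{i-1,i}$ in its upper-left corner. For each $i$ let $W_i=Q_{i-1}\cdot T_{i-1,i}\cdot P_i$ be any simple factorization of $W_i$ with respect to the rectangle $R_{i-1,i}$ (i.e. $(b_{i-1,i})^{a_{i-1,i}}$). Then $(W_1,\dots,W_n)$ is a factor sequence of $\{T_{ij}\}$ if and only if $Q_0$ and $P_n$ are empty and $(P_1\cdot Q_1,\dots,P_{n-1}\cdot Q_{n-1})$ is a factor sequence of the array $\{T'_{ij}\}_{0\le i<j\le n-1}$, $T'_{ij}=T_{i,j+1}$ (the bottom $n-1$ rows of the tableau diagram).
   Context: Rank conditions: nonnegative integers $r_{ij}$, $0\le i\le j\le n$, with $r_{ij}\le\min(r_{i,j-1},r_{i+1,j})$ for $i<j$ and $r_{ij}-r_{i,j-1}-r_{i+1,j}+r_{i+1,j-1}\ge0$ for $j-i\ge2$. For $i<j$, $a_{ij}=r_{i+1,j}-r_{ij}$, $b_{ij}=r_{i,j-1}-r_{ij}$, and $R_{ij}$ is the rectangle $(b_{ij})^{a_{ij}}$ with $a_{ij}$ rows and $b_{ij}$ columns (possibly empty, but $a_{ij},b_{ij}$ are still recorded). Tableaux are semistandard Young tableaux with integer entries (the empty tableau allowed); $T\cdot U$ is the product of tableaux (row-insert into $T$ the row reading word of $U$, rows read left to right from bottom to top); a factorization $W=P\cdot Q$ means tableaux $P,Q$ with product $W$. A tableau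 diagram for $r$ is a family $\{T_{ij}\}$, $T_{ij}$ of shape $R_{ij}$, with every entry of $T_{ij}$ strictly larger than every entry of $T_{kl}$ whenever $i\le k<l\le j$, $(k,l)\ne(i,j)$. Factor sequences of a triangular array $\{T_{ij}\}_{0\le i<j\le m}$: for $m=1$ only $(T_{01})$; for $m\ge2$, all sequences $(T_{01}\cdot P_1,\;Q_1\cdot T_{12}\cdot P_2,\dots,Q_{m-1}\cdot T_{m-1,m})$ where $(U_1,\dots,U_{m-1})$ is a factor sequence of $\{T_{i,j+1}\}_{0\le i<j\le m-1}$ and $U_i=P_i\cdot Q_i$ are arbitrary factorizations. Let $a,b\ge0$ and $T$ a tableau of shape $(b)^a$. A tableau $W$ contains $T$ in its upper-left corner if the shape of $W$ contains $(b)^a$ and the entries of $W$ in it form $T$. Then let $Q_0$ be the part of $W$ in rows $>a$ and columns $\le b$, $P_0$ the part in rows $\le a$ and columns $>b$, and $Z$ the part in rows $>a$ and columns $>b$ (each translated to a straight-shape tableau). A simple factorization of $W$ with respect to $(b)^a$ is a factorization $W=Q\cdot T\cdot P$ such that $Q=Q_0\cdot\tilde Q$ and $P=\tilde P\cdot P_0$ for some factorization $Z=\tilde Q\cdot\tilde P$. (E.g. the canonical factorization: $Q$ = rows of $W$ below row $a$, $P=P_0$.) -}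

module Defs where

open import Data.Nat as ℕ using (ℕ; zero; suc; _∸_; _+_)
open import Data.Integer as ℤ using (ℤ)
open import Data.Bool using (Bool; true; false; not; if_then_else_)
open import Data.Maybe using (Maybe; just; nothing)
open import Data.List using (List; []; _∷_; length; map; take; drop; concat; reverse; foldl; replicate; filter)
open import Data.List.Relation.Unary.All using (All)
open import Data.List.Relation.Unary.Linked using (Linked)
open import Data.List.Membership.Propositional using (_∈_)
open import Data.Product using (Σ; _×_; _,_)
open import Data.Unit using (⊤)
open import Data.Empty using (⊥)
open import Relation.Binary.PropositionalEquality using (_≡_; _≢_)
open import Relation.Nullary using (¬_)
open import Relation.Nullary.Decidable using (does)

-- Tableaux: list of rows, top row first, every row nonempty.
-- The empty tableau is [].

Row : Set
Row = List ℤ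

Tableau : Set
Tableau = List Row

-- strict column condition between a row (above) and the next row (below);
-- also forces the lower row to be no longer than the upper one
ColStrict : Row → Row → Set
ColStrict _        []       = ⊤
ColStrict []       (_ ∷ _)  = ⊥
ColStrict (x ∷ xs) (y ∷ ys) = (x ℤ.< y) × ColStrict xs ys

NonEmptyRow : Row → Set
NonEmptyRow r = 0 ℕ.< length r

IsTableau : Tableau → Set
IsTableau t = All NonEmptyRow t × All (Linked ℤ._≤_) t × Linked ColStrict t

shape : Tableau → List ℕ
shape t = map length t

rect : ℕ → ℕ → List ℕ
rect a zero    = []
rect a (suc b) = replicate a (suc b)

_∈T_ : ℤ → Tableau → Set
x ∈T t = x ∈ concat t

insertRow : ℤ → Row → Maybe ℤ × Row
insertRow x []       = nothing , (x ∷ [])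
insertRow x (y ∷ ys) with does (x ℤ.<? y)
... | true  = just y , (x ∷ ys)
... | false with insertRow x ys
...   | (m , ys') = m , (y ∷ ys')

insert : Tableau → ℤ → Tableau
insert []         x = (x ∷ []) ∷ []
insert (r ∷ rows) x with insertRow x r
... | (nothing , r') = r' ∷ rows
... | (just y  , r') = r' ∷ insert rows y

readingWord : Tableau → List ℤ
readingWord u = concat (reverse u)

infixl 7 _·_
_·_ : Tableau → Tableau → Tableau
t · u = foldl insert t (readingWord u)

RankConditions : ℕ → (ℕ → ℕ → ℕ) → Set
RankConditions n r =
  (∀ i j → i ℕ.< j → j ℕ.≤ n →
     (r i j ℕ.≤ r i (j ∸ 1)) × (r i j ℕ.≤ r (suc i) j))
  × (∀ i j → 2 + i ℕ.≤ j → j ℕ.≤ n →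
     r i (j ∸ 1) + r (suc i) j ℕ.≤ r i j + r (suc i) (j ∸ 1))

-- a_ij = r_{i+1,j} - r_ij, b_ij = r_{i,j-1} - r_ij (nonnegative under the
-- rank conditions, so truncated subtraction is exact)
aR : (ℕ → ℕ → ℕ) → ℕ → ℕ → ℕ
aR r i j = r (suc i) j ∸ r i j

bR : (ℕ → ℕ → ℕ) → ℕ → ℕ → ℕ
bR r i j = r i (j ∸ 1) ∸ r i j

TableauDiagram : ℕ → (ℕ → ℕ → ℕ) → (ℕ → ℕ → Tableau) → Set
TableauDiagram n r T =
  (∀ i j → i ℕ.< j → j ℕ.≤ n →
     IsTableau (T i j) × (shape (T i j) ≡ rect (aR r i j) (bR r i j)))
  × (∀ i j k l → i ℕ.< j → j ℕ.≤ n → i ℕ.≤ k → k ℕ.< l → l ℕ.≤ j →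
       ¬ ((k ≡ i) × (l ≡ j)) →
       ∀ x y → x ∈T T i j → y ∈T T k l → y ℤ.< x)

-- Factor sequences.  A sequence (W_1,…,W_m) is given as a function
-- W : ℕ → Tableau of which only W 1 … W m matter.

Factorization : Tableau → Tableau → Tableau → Set
Factorization U P Q = IsTableau P × IsTableau Q × (U ≡ P · Q)

FactorSeq : ℕ → (ℕ → ℕ → Tableau) → (ℕ → Tableau) → Set
FactorSeq zero          T W = ⊥
FactorSeq (suc zero)    T W = W 1 ≡ T 0 1
FactorSeq (suc (suc k)) T W =
  Σ (ℕ → Tableau) λ U → Σ (ℕ → Tableau) λ P → Σ (ℕ → Tableau) λ Q →
    FactorSeq (suc k) (λ i j → T i (suc j)) U
    × (∀ i → 1 ℕ.≤ i → i ℕ.≤ suc k → Factorization (U i) (P i) (Q i))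
    × (W 1 ≡ T 0 1 · P 1)
    × (∀ i → 2 ℕ.≤ i → i ℕ.≤ suc k → W i ≡ Q (i ∸ 1) · T (i ∸ 1) i · P i)
    × (W (suc (suc k)) ≡ Q (suc k) · T (suc k) (suc (suc k)))

dropEmpty : Tableau → Tableau
dropEmpty = filter (λ r → 1 ℕ.≤? length r)

rowLength : Tableau → ℕ → ℕ
rowLength []       _       = 0
rowLength (r ∷ _)  zero    = length r
rowLength (_ ∷ rs) (suc k) = rowLength rs k

ContainsUL : Tableau → ℕ → ℕ → Tableau → Set
ContainsUL W a b T =
  (∀ k → k ℕ.< a → b ℕ.≤ rowLength W k)
  × (T ≡ dropEmpty (map (take b) (take a W)))

Q₀-part : Tableau → ℕ → ℕ → Tableau
Q₀-part W a b = dropEmpty (map (take b) (drop a W))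

P₀-part : Tableau → ℕ → ℕ → Tableau
P₀-part W a b = dropEmpty (map (drop b) (take a W))

Z-part : Tableau → ℕ → ℕ → Tableau
Z-part W a b = dropEmpty (map (drop b) (drop a W))

SimpleFactorization : Tableau → ℕ → ℕ → Tableau → Tableau → Tableau → Set
SimpleFactorization W a b T Q P =
  IsTableau Q × IsTableau P × (W ≡ Q · T · P)
  × Σ Tableau λ Q~ → Σ Tableau λ P~ →
      IsTableau Q~ × IsTableau P~
      × (Z-part W a b ≡ Q~ · P~)
      × (Q ≡ Q₀-part W a b · Q~)
      × (P ≡ P~ · P₀-part W a b)

{-# OPTIONS --safe #-}
module Submission where

-- If W = Q · T · P with T an a × b rectangle whose entries are smaller than those of Q and P,
-- then the part of Q right of column b can be moved past T into P, and after that the part of P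
-- below row a can be moved past T into Q.  These two moves already reach the factorization in
-- which Q consists of the rows of W below row a, and from there a third move of the first kind
-- reaches any simple factorization of W.
--
-- Such a move replaces two neighbouring tableaux U, V of the lower sequence, with U = Y · X, by
-- Y, X · V, where X is a right factor of the part of U beyond column b (or symmetrically for
-- rows).  By induction U may be factored around its own rectangle, which has at most b columns,
-- so that the right factor of U ends in X.  Hence X can be passed on to the neighbour without
-- changing the sequence one level further down.  At the ends of the sequence the outer factors
-- are empty, which forces X to be empty.

open import Defs
open import Data.Nat as ℕ using (ℕ; zero; suc; _∸_; _≤_; _<_; z≤n; s≤s)
import Data.Nat.Properties as ℕ
open import Data.Integer as ℤ using (ℤ)
import Data.Integer.Properties as ℤ
open import Data.Maybe using (Maybe; just; nothing)
open import Data.List using (List; []; _∷_; _++_; length; map; take; drop; concat; reverse; foldl; fromMaybe; replicate)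
import Data.List.Properties as List
open import Data.List.Relation.Unary.All as All using (All; []; _∷_)
import Data.List.Relation.Unary.All.Properties as All
open import Data.List.Relation.Unary.Linked as Linked using (Linked; []; [-]; _∷_)
import Data.List.Relation.Unary.Linked.Properties as Linked
open import Data.List.Relation.Binary.Permutation.Propositional using (_↭_; ↭-refl; ↭-reflexive; ↭-sym; ↭-trans; prep; swap)
import Data.List.Relation.Binary.Permutation.Propositional.Properties as Perm
open import Data.Product using (∃; ∃₂; _×_; _,_; proj₁; proj₂)
open import Data.Sum as Sum using (_⊎_; inj₁; inj₂)
open import Data.Unit using (⊤; tt)
open import Data.Empty using (⊥-elim)
open import Function using (_∘_)
open import Function.Bundles using (_⇔_; mk⇔)
open import Relation.Nullary using (Dec; ¬_; yes; no; contradiction)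
open import Relation.Nullary.Decidable using (dec-true; dec-false)
open import Relation.Binary.PropositionalEquality using (_≡_; _≢_; refl; sym; trans; cong; cong₂; subst; subst₂; module ≡-Reasoning)

-- Only the forward implication needs the moves: conversely, the given `Q` and `P` are themselves
-- the factorizations that the definition asks for. The two kinds of move are mirror images, but row
-- insertion is not symmetric, and the transpose of a semistandard tableau need not be semistandard.
-- For rows, everything can be read off from insertion, which works downwards (`take-◁`, `drop-◁`).
-- For columns, the counterpart `·-columns` is invisible in the algorithm; it is extracted from
-- associativity, hence from Knuth equivalence. The bounds on the rectangles are two readings of the
-- second-difference inequality among the rank conditions.

Sorted : Row → Set
Sorted = Linked ℤ._≤_

sorted-head : ∀ {h t} → Sorted (h ∷ t) → All (h ℤ.≤_) t
sorted-head [-]       = []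
sorted-head (p ∷ s) = Linked.Linked⇒All ℤ.≤-trans p s

sorted-∷ : ∀ {h t} → All (h ℤ.≤_) t → Sorted t → Sorted (h ∷ t)
sorted-∷ []      []        = [-]
sorted-∷ (p ∷ _) s@([-])   = p ∷ s
sorted-∷ (p ∷ _) s@(_ ∷ _) = p ∷ s

absurd : ∀ {ℓ} {A : Set ℓ} {x y : ℤ} → x ℤ.< y → y ℤ.≤ x → A
absurd p q = ⊥-elim (ℤ.<⇒≱ p q)

-- Row insertion

infix 4 _⊢_↦_,_
-- The graph of `insertRow`: matching on it shows where the letter lands, without unfolding nested
-- comparisons.
data _⊢_↦_,_ (x : ℤ) : Row → Maybe ℤ → Row → Set where
  append : x ⊢ [] ↦ nothing , x ∷ []
  bump   : ∀ {h t} → x ℤ.< h → x ⊢ h ∷ t ↦ just h , x ∷ t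
  skip   : ∀ {h t m t′} → h ℤ.≤ x → x ⊢ t ↦ m , t′ → x ⊢ h ∷ t ↦ m , h ∷ t′

⊢-total : ∀ x r → ∃₂ λ m r′ → x ⊢ r ↦ m , r′
⊢-total x []      = _ , _ , append
⊢-total x (h ∷ t) with x ℤ.<? h
... | yes p = _ , _ , bump p
... | no ¬p with ⊢-total x t
...   | _ , _ , i = _ , _ , skip (ℤ.≮⇒≥ ¬p) i

⊢-insertRow : ∀ {x r m r′} → x ⊢ r ↦ m , r′ → insertRow x r ≡ (m , r′)
⊢-insertRow append = refl
⊢-insertRow {x} (bump {h} p) rewrite dec-true (x ℤ.<? h) p = refl
⊢-insertRow {x} (skip {h} p i)
  rewrite dec-false (x ℤ.<? h) (ℤ.≤⇒≯ p) | ⊢-insertRow i = refl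

⊢-All : ∀ {P : ℤ → Set} {x r m r′} → x ⊢ r ↦ m , r′ → P x → All P r →
  All P r′ × All P (fromMaybe m)
⊢-All append     px _        = px ∷ [] , []
⊢-All (bump _)   px (p ∷ ps) = px ∷ ps , p ∷ []
⊢-All (skip _ i) px (p ∷ ps) with ⊢-All i px ps
... | qs , q = p ∷ qs , q

⊢-sorted : ∀ {x r m r′} → x ⊢ r ↦ m , r′ → Sorted r → Sorted r′
⊢-sorted append     s = [-]
⊢-sorted (bump p)   s =
  sorted-∷ (All.map (ℤ.≤-trans (ℤ.<⇒≤ p)) (sorted-head s)) (Linked.tail s)
⊢-sorted (skip p i) s =
  sorted-∷ (proj₁ (⊢-All i p (sorted-head s))) (⊢-sorted i (Linked.tail s))

⊢-bumped-All : ∀ {P : ℤ → Set} {x r y r′} → x ⊢ r ↦ just y , r′ → All P r → P y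
⊢-bumped-All (bump _)   (p ∷ _)  = p
⊢-bumped-All (skip _ i) (_ ∷ ps) = ⊢-bumped-All i ps

⊢-bumped : ∀ {x r y r′} → x ⊢ r ↦ just y , r′ → x ℤ.< y
⊢-bumped (bump p)   = p
⊢-bumped (skip _ i) = ⊢-bumped i

-- The cell that received `y` holds a letter at most `z`, so `z` passes it and lands strictly
-- further right, where the entries of the sorted row are no smaller.
⊢-mono : ∀ {y z t m t₁ m′ t₂} → Sorted t → y ℤ.≤ z →
  y ⊢ t ↦ m , t₁ → z ⊢ t₁ ↦ m′ , t₂ →
  m′ ≡ nothing ⊎ (∃₂ λ u v → m ≡ just u × m′ ≡ just v × u ℤ.≤ v)
⊢-mono s y≤z append     (bump z<y)        = absurd z<y y≤z
⊢-mono s y≤z append     (skip _ append)   = inj₁ refl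
⊢-mono s y≤z (bump p)   (bump z<y)        = absurd z<y y≤z
⊢-mono {m′ = nothing} s y≤z (bump p) (skip q i) = inj₁ refl
⊢-mono {m′ = just v}  s y≤z (bump {h} p) (skip q i) =
  inj₂ (h , v , refl , refl , ⊢-bumped-All i (sorted-head s))
⊢-mono s y≤z (skip p i) (bump z<h)        = absurd (ℤ.≤-<-trans y≤z z<h) p
⊢-mono s y≤z (skip p i) (skip q j)        = ⊢-mono (Linked.tail s) y≤z i j

-- `y` cannot pass the cell that received `z`: it bumps either `z` itself or an entry further left,
-- which `z` had passed.
⊢-anti : ∀ {y z t v t₁ m t₂} → y ℤ.< z →
  z ⊢ t ↦ just v , t₁ → y ⊢ t₁ ↦ m , t₂ → ∃ λ u → m ≡ just u × u ℤ.< v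
⊢-anti y<z (bump z<h) (bump _)   = _ , refl , z<h
⊢-anti y<z (bump z<h) (skip q _) = absurd y<z q
⊢-anti y<z (skip p i) (bump _)   = _ , refl , ℤ.≤-<-trans p (⊢-bumped i)
⊢-anti y<z (skip p i) (skip _ j) = ⊢-anti y<z i j

-- Knuth equivalence

data Knuth : List ℤ → List ℤ → Set where
  yzx : ∀ {x y z} → x ℤ.< y → y ℤ.≤ z → Knuth (y ∷ z ∷ x ∷ []) (y ∷ x ∷ z ∷ [])
  xzy : ∀ {x y z} → x ℤ.≤ y → y ℤ.< z → Knuth (x ∷ z ∷ y ∷ []) (z ∷ x ∷ y ∷ [])

infix 4 _≈_
data _≈_ : List ℤ → List ℤ → Set where
  knuth   : ∀ {v w} → Knuth v w → v ≈ w
  ≈-refl  : ∀ {w} → w ≈ w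
  ≈-sym   : ∀ {v w} → v ≈ w → w ≈ v
  ≈-trans : ∀ {u v w} → u ≈ v → v ≈ w → u ≈ w
  ++-cong : ∀ {v v′ w w′} → v ≈ v′ → w ≈ w′ → v ++ w ≈ v′ ++ w′

≈-reflexive : ∀ {v w} → v ≡ w → v ≈ w
≈-reflexive refl = ≈-refl

≈⇒↭ : ∀ {v w} → v ≈ w → v ↭ w
≈⇒↭ (knuth (yzx _ _)) = prep _ (swap _ _ ↭-refl)
≈⇒↭ (knuth (xzy _ _)) = swap _ _ ↭-refl
≈⇒↭ ≈-refl        = ↭-refl
≈⇒↭ (≈-sym e)     = ↭-sym (≈⇒↭ e)
≈⇒↭ (≈-trans e f) = ↭-trans (≈⇒↭ e) (≈⇒↭ f)
≈⇒↭ (++-cong e f) = Perm.++⁺ (≈⇒↭ e) (≈⇒↭ f)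

infixr 5 _⊕_
_⊕_ : Maybe ℤ → List ℤ → List ℤ
m ⊕ w = fromMaybe m ++ w

-- Insertion respects Knuth relations row by row: the two words leave the same row behind and hand
-- related words to the next one, which drives the induction in `◁-knuth`. Equality covers the cases
-- in which some letter is appended, so that fewer than three letters are bumped.
⊢-yzx : ∀ {x y z r m₁ r₁ m₂ r₂ m₃ r₃} → Sorted r → x ℤ.< y → y ℤ.≤ z →
  y ⊢ r ↦ m₁ , r₁ → z ⊢ r₁ ↦ m₂ , r₂ → x ⊢ r₂ ↦ m₃ , r₃ →
  ∃ λ n₂ → ∃ λ n₃ → ∃ λ s → x ⊢ r₁ ↦ n₂ , s × z ⊢ s ↦ n₃ , r₃ ×
    (m₁ ⊕ m₂ ⊕ m₃ ⊕ [] ≡ m₁ ⊕ n₂ ⊕ n₃ ⊕ [] ⊎ Knuth (m₁ ⊕ m₂ ⊕ m₃ ⊕ []) (m₁ ⊕ n₂ ⊕ n₃ ⊕ []))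
⊢-yzx s x<y y≤z append (bump z<y) k = absurd z<y y≤z
⊢-yzx s x<y y≤z append (skip p append) (bump q) =
  _ , _ , _ , bump x<y , skip (ℤ.≤-trans (ℤ.<⇒≤ x<y) y≤z) append , inj₁ refl
⊢-yzx s x<y y≤z append (skip p append) (skip q k) = absurd x<y q
⊢-yzx s x<y y≤z (bump y<h) (bump z<y) k = absurd z<y y≤z
⊢-yzx s x<y y≤z (bump y<h) (skip p j) (skip q k) = absurd x<y q
⊢-yzx {m₂ = nothing} s x<y y≤z (bump y<h) (skip p j) (bump q) =
  _ , _ , _ , bump x<y , skip (ℤ.≤-trans (ℤ.<⇒≤ x<y) y≤z) j , inj₁ refl
⊢-yzx {m₂ = just v} s x<y y≤z (bump y<h) (skip p j) (bump q)
  with ⊢-mono s y≤z (bump y<h) (skip p j)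
... | inj₂ (_ , _ , refl , refl , h≤v) =
  _ , _ , _ , bump x<y , skip (ℤ.≤-trans (ℤ.<⇒≤ x<y) y≤z) j , inj₂ (yzx y<h h≤v)
⊢-yzx s x<y y≤z (skip h≤y i) (bump z<h) k = absurd (ℤ.≤-<-trans y≤z z<h) h≤y
⊢-yzx s x<y y≤z (skip h≤y i) (skip h≤z j) (bump x<h)
  with ⊢-mono (Linked.tail s) y≤z i j
... | inj₁ refl =
  _ , _ , _ , bump x<h , skip (ℤ.≤-trans (ℤ.<⇒≤ x<y) y≤z) j , inj₁ refl
... | inj₂ (_ , _ , refl , refl , u≤v) =
  _ , _ , _ , bump x<h , skip (ℤ.≤-trans (ℤ.<⇒≤ x<y) y≤z) j ,
  inj₂ (yzx (ℤ.≤-<-trans h≤y (⊢-bumped i)) u≤v)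
⊢-yzx s x<y y≤z (skip h≤y i) (skip h≤z j) (skip h≤x k)
  with ⊢-yzx (Linked.tail s) x<y y≤z i j k
... | _ , _ , _ , i′ , j′ , e = _ , _ , _ , skip h≤x i′ , skip h≤z j′ , e

⊢-xzy : ∀ {x y z r m₁ r₁ m₂ r₂ m₃ r₃} → Sorted r → x ℤ.≤ y → y ℤ.< z →
  x ⊢ r ↦ m₁ , r₁ → z ⊢ r₁ ↦ m₂ , r₂ → y ⊢ r₂ ↦ m₃ , r₃ →
  ∃ λ n₁ → ∃ λ n₂ → ∃ λ n₃ → ∃ λ s₁ → ∃ λ s₂ →
    z ⊢ r ↦ n₁ , s₁ × x ⊢ s₁ ↦ n₂ , s₂ × y ⊢ s₂ ↦ n₃ , r₃ ×
    (m₁ ⊕ m₂ ⊕ m₃ ⊕ [] ≡ n₁ ⊕ n₂ ⊕ n₃ ⊕ [] ⊎ Knuth (m₁ ⊕ m₂ ⊕ m₃ ⊕ []) (n₁ ⊕ n₂ ⊕ n₃ ⊕ []))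
⊢-xzy s x≤y y<z append (bump z<x) k = absurd z<x (ℤ.≤-trans x≤y (ℤ.<⇒≤ y<z))
⊢-xzy s x≤y y<z append (skip p append) (bump y<x) = absurd y<x x≤y
⊢-xzy s x≤y y<z append (skip p append) (skip q (skip z≤y k)) = absurd y<z z≤y
⊢-xzy s x≤y y<z append (skip p append) (skip q (bump _)) =
  _ , _ , _ , _ , _ , append , bump (ℤ.≤-<-trans x≤y y<z) , skip x≤y append , inj₁ refl
⊢-xzy s x≤y y<z (bump x<h) (bump z<x) k = absurd z<x (ℤ.≤-trans x≤y (ℤ.<⇒≤ y<z))
⊢-xzy s x≤y y<z (bump x<h) (skip p j) (bump y<x) = absurd y<x x≤y
-- In the other order `z` meets `h` before `x` has replaced it, so the outcome depends on whether
-- `z` bumps or passes `h`.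
⊢-xzy {z = z} s x≤y y<z (bump {h} x<h) (skip p j) (skip q k) with z ℤ.<? h
⊢-xzy s x≤y y<z (bump x<h) (skip p append) (skip q (bump _)) | yes z<h =
  _ , _ , _ , _ , _ , bump z<h , bump (ℤ.≤-<-trans x≤y y<z) , skip x≤y append , inj₁ refl
⊢-xzy s x≤y y<z (bump x<h) (skip p append) (skip q (skip z≤y k)) | yes z<h = absurd y<z z≤y
⊢-xzy s x≤y y<z (bump x<h) (skip p (bump z<g)) (skip q (skip z≤y k)) | yes z<h = absurd y<z z≤y
-- With `g` the entry after `h`, the bumped words are `h g z` and `h z g`: a relation of type `xzy`
-- induces one of type `yzx` in the next row.
⊢-xzy s x≤y y<z (bump x<h) (skip p (bump z<g)) (skip q (bump _)) | yes z<h =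
  _ , _ , _ , _ , _ , bump z<h , bump (ℤ.≤-<-trans x≤y y<z) ,
  skip x≤y (bump (ℤ.<-trans y<z z<g)) , inj₂ (yzx z<h (All.head (sorted-head s)))
⊢-xzy s x≤y y<z (bump x<h) (skip p (skip g≤z j)) k | yes z<h =
  absurd (ℤ.<-≤-trans z<h (All.head (sorted-head s))) g≤z
⊢-xzy {m₂ = nothing} s x≤y y<z (bump x<h) (skip p j) (skip q k) | no ¬p =
  _ , _ , _ , _ , _ , skip (ℤ.≮⇒≥ ¬p) j , bump x<h , skip q k , inj₁ refl
⊢-xzy {m₂ = just _} s x≤y y<z (bump x<h) (skip p j) (skip q k) | no ¬p
  with ⊢-anti y<z j k
... | _ , refl , u<v =
  _ , _ , _ , _ , _ , skip (ℤ.≮⇒≥ ¬p) j , bump x<h , skip q k ,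
  inj₂ (xzy (⊢-bumped-All k (proj₁ (⊢-All j (ℤ.≮⇒≥ ¬p) (sorted-head s)))) u<v)
⊢-xzy s x≤y y<z (skip h≤x i) (bump z<h) k =
  absurd (ℤ.<-trans (ℤ.≤-<-trans x≤y y<z) z<h) h≤x
⊢-xzy s x≤y y<z (skip h≤x i) (skip h≤z j) (bump y<h) =
  absurd (ℤ.≤-<-trans x≤y y<h) h≤x
⊢-xzy s x≤y y<z (skip h≤x i) (skip h≤z j) (skip h≤y k)
  with ⊢-xzy (Linked.tail s) x≤y y<z i j k
... | _ , _ , _ , _ , _ , i′ , j′ , k′ , e =
  _ , _ , _ , _ , _ , skip h≤z i′ , skip h≤x j′ , skip h≤y k′ , e

-- Tableaux

top : Tableau → Row
top []      = []
top (r ∷ _) = r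

data Tab : Tableau → Set where
  []  : Tab []
  row : ∀ {r R} → NonEmptyRow r → Sorted r → ColStrict r (top R) → Tab R → Tab (r ∷ R)

Tab⇒IsTableau : ∀ {T} → Tab T → IsTableau T
Tab⇒IsTableau [] = [] , [] , []
Tab⇒IsTableau (row {R = []} n s c t) = n ∷ [] , s ∷ [] , [-]
Tab⇒IsTableau (row {R = _ ∷ _} n s c t) with Tab⇒IsTableau t
... | ns , ss , cs = n ∷ ns , s ∷ ss , c ∷ cs

IsTableau⇒Tab : ∀ {T} → IsTableau T → Tab T
IsTableau⇒Tab {[]} _ = []
IsTableau⇒Tab {_ ∷ []} (n ∷ [] , s ∷ [] , [-]) = row n s tt []
IsTableau⇒Tab {_ ∷ _ ∷ _} (n ∷ ns , s ∷ ss , c ∷ cs) = row n s c (IsTableau⇒Tab (ns , ss , cs))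

infixl 7 _◁_
_◁_ : Tableau → List ℤ → Tableau
_◁_ = foldl insert

insert-∷ : ∀ {x r m r′} R → x ⊢ r ↦ m , r′ → insert (r ∷ R) x ≡ r′ ∷ R ◁ fromMaybe m
insert-∷ {m = nothing} R i rewrite ⊢-insertRow i = refl
insert-∷ {m = just y}  R i rewrite ⊢-insertRow i = refl

insert-top : ∀ R x → ∃ λ m → x ⊢ top R ↦ m , top (insert R x)
insert-top [] x = _ , append
insert-top (r ∷ R) x with ⊢-total x r
... | _ , _ , i rewrite insert-∷ R i = _ , i

⊢-ColStrict : ∀ {x r m r′} s → ColStrict r s → x ⊢ r ↦ m , r′ → ColStrict r′ s
⊢-ColStrict []      c       i          = tt
⊢-ColStrict (_ ∷ _) (c , d) (bump p)   = ℤ.<-trans p c , d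
⊢-ColStrict (_ ∷ s) (c , d) (skip _ i) = c , ⊢-ColStrict s d i

-- The bumped letter lands weakly left of its old column, because the entry below its old cell, if
-- there is one, is larger than it. The entries above it there are at most `x`, which is smaller.
⊢-⊢-ColStrict : ∀ {x r y r′ s m s′} → ColStrict r s →
  x ⊢ r ↦ just y , r′ → y ⊢ s ↦ m , s′ → ColStrict r′ s′
⊢-⊢-ColStrict c (bump p)   append     = p , tt
⊢-⊢-ColStrict c (skip p i) append     = ℤ.≤-<-trans p (⊢-bumped i) , tt
⊢-⊢-ColStrict (_ , c) (bump p)   (bump _)   = p , c
⊢-⊢-ColStrict (h<g , c) (bump p) (skip q j) = absurd h<g q
⊢-⊢-ColStrict {s = _ ∷ s} (_ , c) (skip p i) (bump _) = ℤ.≤-<-trans p (⊢-bumped i) , ⊢-ColStrict s c i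
⊢-⊢-ColStrict (h<g , c) (skip p i) (skip _ j) = h<g , ⊢-⊢-ColStrict c i j

⊢-nonempty : ∀ {x r m r′} → x ⊢ r ↦ m , r′ → NonEmptyRow r′
⊢-nonempty append     = s≤s z≤n
⊢-nonempty (bump _)   = s≤s z≤n
⊢-nonempty (skip _ _) = s≤s z≤n

insert-Tab : ∀ {R} x → Tab R → Tab (insert R x)
insert-Tab x [] = row (s≤s z≤n) [-] tt []
insert-Tab x (row {r} {R} n s c t) with ⊢-total x r
... | nothing , r′ , i rewrite insert-∷ R i = row (⊢-nonempty i) (⊢-sorted i s) (⊢-ColStrict (top R) c i) t
... | just y , r′ , i rewrite insert-∷ R i =
  row (⊢-nonempty i) (⊢-sorted i s) (⊢-⊢-ColStrict c i (proj₂ (insert-top R y))) (insert-Tab y t)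

◁-Tab : ∀ {R} w → Tab R → Tab (R ◁ w)
◁-Tab []      t = t
◁-Tab (x ∷ w) t = ◁-Tab w (insert-Tab x t)

◁-++ : ∀ R v w → R ◁ (v ++ w) ≡ R ◁ v ◁ w
◁-++ = List.foldl-++ insert

◁-three : ∀ {x y z r m₁ r₁ m₂ r₂ m₃ r₃} R →
  x ⊢ r ↦ m₁ , r₁ → y ⊢ r₁ ↦ m₂ , r₂ → z ⊢ r₂ ↦ m₃ , r₃ →
  (r ∷ R) ◁ (x ∷ y ∷ z ∷ []) ≡ r₃ ∷ R ◁ (m₁ ⊕ m₂ ⊕ m₃ ⊕ [])
◁-three {m₁ = m₁} {m₂ = m₂} {m₃ = m₃} R i j k
  rewrite insert-∷ R i | insert-∷ (R ◁ fromMaybe m₁) j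
        | insert-∷ (R ◁ fromMaybe m₁ ◁ fromMaybe m₂) k
        | ◁-++ R (fromMaybe m₁) (m₂ ⊕ m₃ ⊕ [])
        | ◁-++ (R ◁ fromMaybe m₁) (fromMaybe m₂) (m₃ ⊕ [])
        | List.++-identityʳ (fromMaybe m₃) = refl

◁-knuth : ∀ {R v w} → Tab R → Knuth v w → R ◁ v ≡ R ◁ w
◁-knuth [] (yzx x<y y≤z) =
  trans (◁-three [] append (skip y≤z append) (bump x<y))
    (sym (◁-three [] append (bump x<y) (skip (ℤ.≤-trans (ℤ.<⇒≤ x<y) y≤z) append)))
◁-knuth [] (xzy x≤y y<z) =
  trans (◁-three [] append (skip (ℤ.≤-trans x≤y (ℤ.<⇒≤ y<z)) append) (skip x≤y (bump y<z)))
    (sym (◁-three [] append (bump (ℤ.≤-<-trans x≤y y<z)) (skip x≤y append)))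
◁-knuth (row {r} {R} n s c t) (yzx {x} {y} {z} x<y y≤z)
  with ⊢-total y r
... | _ , r₁ , i with ⊢-total z r₁
... | _ , r₂ , j with ⊢-total x r₂
... | _ , r₃ , k with ⊢-yzx s x<y y≤z i j k
... | _ , _ , _ , j′ , k′ , inj₁ e =
  trans (◁-three R i j k) (trans (cong (λ w → r₃ ∷ R ◁ w) e) (sym (◁-three R i j′ k′)))
... | _ , _ , _ , j′ , k′ , inj₂ e =
  trans (◁-three R i j k) (trans (cong (r₃ ∷_) (◁-knuth t e)) (sym (◁-three R i j′ k′)))
◁-knuth (row {r} {R} n s c t) (xzy {x} {y} {z} x≤y y<z)
  with ⊢-total x r
... | _ , r₁ , i with ⊢-total z r₁
... | _ , r₂ , j with ⊢-total y r₂
... | _ , r₃ , k with ⊢-xzy s x≤y y<z i j k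
... | _ , _ , _ , _ , _ , i′ , j′ , k′ , inj₁ e =
  trans (◁-three R i j k) (trans (cong (λ w → r₃ ∷ R ◁ w) e) (sym (◁-three R i′ j′ k′)))
... | _ , _ , _ , _ , _ , i′ , j′ , k′ , inj₂ e =
  trans (◁-three R i j k) (trans (cong (r₃ ∷_) (◁-knuth t e)) (sym (◁-three R i′ j′ k′)))

◁-≈ : ∀ {R v w} → Tab R → v ≈ w → R ◁ v ≡ R ◁ w
◁-≈ t (knuth e)     = ◁-knuth t e
◁-≈ t ≈-refl        = refl
◁-≈ t (≈-sym e)     = sym (◁-≈ t e)
◁-≈ t (≈-trans e f) = trans (◁-≈ t e) (◁-≈ t f)
◁-≈ {R} t (++-cong {v} {v′} {w} {w′} e f) = begin
  R ◁ (v ++ w)    ≡⟨ ◁-++ R v w ⟩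
  R ◁ v ◁ w       ≡⟨ cong (_◁ w) (◁-≈ t e) ⟩
  R ◁ v′ ◁ w      ≡⟨ ◁-≈ (◁-Tab v′ t) f ⟩
  R ◁ v′ ◁ w′     ≡⟨ ◁-++ R v′ w′ ⟨
  R ◁ (v′ ++ w′)  ∎
  where open ≡-Reasoning

-- Reading words, associativity and entries of products

⊢-append : ∀ {x r r′} → x ⊢ r ↦ nothing , r′ → r′ ≡ r ++ x ∷ []
⊢-append append         = refl
⊢-append (skip {h} _ i) = cong (h ∷_) (⊢-append i)

slide : ∀ {x h t} → Sorted (h ∷ t) → x ℤ.< h → h ∷ (t ++ x ∷ []) ≈ h ∷ x ∷ t
slide [-] p = ≈-refl
slide {h = h} (q ∷ s) p =
  ≈-trans (++-cong (≈-refl {h ∷ []}) (slide s (ℤ.<-≤-trans p q))) (++-cong (knuth (yzx p q)) ≈-refl)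

-- `x` slides left through the larger entries until it stands next to the one it bumps (`yzx`); the
-- bumped letter then slides left through the smaller entries to the front (`xzy`).
⊢-≈ : ∀ {x r y r′} → Sorted r → x ⊢ r ↦ just y , r′ → r ++ x ∷ [] ≈ y ∷ r′
⊢-≈ s (bump p) = slide s p
⊢-≈ s (skip {h} {t′ = []} p ())
⊢-≈ {x} s (skip {h} {t′ = g ∷ _} p i) =
  ≈-trans (++-cong (≈-refl {h ∷ []}) (⊢-≈ (Linked.tail s) i))
    (++-cong (knuth (xzy (All.head (proj₁ (⊢-All i p (sorted-head s)))) (ℤ.≤-<-trans (head≤ i) (⊢-bumped i)))) ≈-refl)
  where
  head≤ : ∀ {t g y t′} → x ⊢ t ↦ just y , g ∷ t′ → g ℤ.≤ x
  head≤ (bump _)   = ℤ.≤-refl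
  head≤ (skip q _) = q

rw : Tableau → List ℤ
rw = readingWord

rw-++ : ∀ X Y → rw (X ++ Y) ≡ rw Y ++ rw X
rw-++ X Y = trans (cong concat (List.reverse-++ X Y)) (sym (List.concat-++ (reverse Y) (reverse X)))

rw-∷ : ∀ r R → rw (r ∷ R) ≡ rw R ++ r
rw-∷ r R = trans (rw-++ (r ∷ []) R) (cong (rw R ++_) (List.++-identityʳ r))

rw-insert : ∀ {R} x → Tab R → rw (insert R x) ≈ rw R ++ x ∷ []
rw-insert x [] = ≈-refl
rw-insert x (row {r} {R} n s c t) with ⊢-total x r
... | nothing , r′ , i rewrite insert-∷ R i | rw-∷ r′ R | rw-∷ r R | ⊢-append i =
  ≈-reflexive (sym (List.++-assoc (rw R) r (x ∷ [])))
... | just y , r′ , i rewrite insert-∷ R i | rw-∷ r′ (insert R y) | rw-∷ r R =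
  ≈-trans (++-cong (rw-insert y t) ≈-refl)
    (≈-trans (≈-reflexive (List.++-assoc (rw R) (y ∷ []) r′))
      (≈-trans (++-cong (≈-refl {rw R}) (≈-sym (⊢-≈ s i))) (≈-reflexive (sym (List.++-assoc (rw R) r (x ∷ []))))))

rw-◁ : ∀ {R} w → Tab R → rw (R ◁ w) ≈ rw R ++ w
rw-◁ {R} [] t = ≈-reflexive (sym (List.++-identityʳ (rw R)))
rw-◁ {R} (x ∷ w) t =
  ≈-trans (rw-◁ w (insert-Tab x t))
    (≈-trans (++-cong (rw-insert x t) ≈-refl) (≈-reflexive (List.++-assoc (rw R) (x ∷ []) w)))

·-Tab : ∀ {X} Y → Tab X → Tab (X · Y)
·-Tab Y t = ◁-Tab (rw Y) t

·-assoc : ∀ {X Y} Z → Tab X → Tab Y → X · Y · Z ≡ X · (Y · Z)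
·-assoc {X} {Y} Z x y = trans (sym (◁-++ X (rw Y) (rw Z))) (sym (◁-≈ x (rw-◁ (rw Z) y)))

concat↭rw : ∀ T → concat T ↭ rw T
concat↭rw [] = ↭-refl
concat↭rw (r ∷ R) = ↭-trans (Perm.++⁺ (↭-refl {x = r}) (concat↭rw R))
  (↭-trans (Perm.++-comm r (rw R)) (↭-reflexive (sym (rw-∷ r R))))

concat-·-↭ : ∀ {X} Y → Tab X → concat (X · Y) ↭ concat X ++ concat Y
concat-·-↭ {X} Y x = ↭-trans (concat↭rw (X · Y)) (↭-trans (≈⇒↭ (rw-◁ (rw Y) x))
  (Perm.++⁺ (↭-sym (concat↭rw X)) (↭-sym (concat↭rw Y))))

-- Inserting a word into a single row

infix 4 _⊢*_↦_,_
-- The third index collects the bumped letters in order. A row acts on the rows below only through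
-- this word, so by `◁-∷` products can be computed row by row.
data _⊢*_↦_,_ : List ℤ → Row → List ℤ → Row → Set where
  []  : ∀ {r} → [] ⊢* r ↦ [] , r
  _∷_ : ∀ {x w r m r₁ u r₂} → x ⊢ r ↦ m , r₁ → w ⊢* r₁ ↦ u , r₂ → x ∷ w ⊢* r ↦ m ⊕ u , r₂

⊢*-total : ∀ w r → ∃₂ λ u r′ → w ⊢* r ↦ u , r′
⊢*-total []      r = _ , _ , []
⊢*-total (x ∷ w) r with ⊢-total x r
... | _ , r₁ , i with ⊢*-total w r₁
...   | _ , _ , j = _ , _ , i ∷ j

⊢*-++ : ∀ {v w r u r₁ u′ r₂} → v ⊢* r ↦ u , r₁ → w ⊢* r₁ ↦ u′ , r₂ → v ++ w ⊢* r ↦ u ++ u′ , r₂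
⊢*-++ [] k = k
⊢*-++ {u′ = u′} (_∷_ {m = m} {u = u} i j) k =
  subst (_ ⊢* _ ↦_, _) (sym (List.++-assoc (fromMaybe m) u u′)) (i ∷ ⊢*-++ j k)

◁-∷ : ∀ {w r u r′} R → w ⊢* r ↦ u , r′ → (r ∷ R) ◁ w ≡ r′ ∷ R ◁ u
◁-∷ R [] = refl
◁-∷ R (_∷_ {m = m} {u = u} i j) rewrite insert-∷ R i | ◁-++ R (fromMaybe m) u = ◁-∷ _ j

infix 4 _≼_ _≺_
_≼_ _≺_ : List ℤ → List ℤ → Set
v ≼ w = All (λ x → All (x ℤ.≤_) w) v
v ≺ w = All (λ x → All (x ℤ.<_) w) v

≺⇒≼ : ∀ {v w} → v ≺ w → v ≼ w
≺⇒≼ = All.map (All.map ℤ.<⇒≤)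

⊢*-skip : ∀ {α w r u r′} → α ≼ w → w ⊢* r ↦ u , r′ → w ⊢* α ++ r ↦ u , α ++ r′
⊢*-skip []       i = i
⊢*-skip (p ∷ ps) i = skips p (⊢*-skip ps i)
  where
  skips : ∀ {h w r u r′} → All (h ℤ.≤_) w → w ⊢* r ↦ u , r′ → w ⊢* h ∷ r ↦ u , h ∷ r′
  skips []       []      = []
  skips (p ∷ ps) (i ∷ j) = skip p i ∷ skips ps j

-- Each letter of `ρ` passes the letters of `ρ` inserted before it and bumps the entry of `α` in its
-- own column. If `ρ` is longer than `α`, its surplus is appended, and then nothing may follow `α`.
⊢*-push : ∀ {ρ α d} → ColStrict ρ α → Sorted ρ → length ρ ≡ length α ⊎ d ≡ [] →
  ρ ⊢* α ++ d ↦ α , ρ ++ d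
⊢*-push {[]}    {[]}    c s e = []
⊢*-push {p ∷ ρ} {[]}    c s (inj₂ refl) =
  append ∷ ⊢*-skip {p ∷ []} (sorted-head s ∷ []) (⊢*-push {ρ} {[]} tt′ (Linked.tail s) (inj₂ refl))
  where
  tt′ : ColStrict ρ []
  tt′ = tt
⊢*-push {p ∷ ρ} {g ∷ α} (c , cs) s e =
  bump c ∷ ⊢*-skip {p ∷ []} (sorted-head s ∷ []) (⊢*-push cs (Linked.tail s) (Sum.map₁ ℕ.suc-injective e))

rw-tail : ∀ D → rw (drop 1 D) ++ top D ≡ rw D
rw-tail []      = refl
rw-tail (d ∷ D) = sym (rw-∷ d D)

-- The rows of `D` arrive from the bottom upwards and settle behind `α`; each pushes out the row of
-- `D` that came before it, so that in the end only the top row stays.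
⊢*-rw : ∀ {α D} → Tab D → α ≼ concat D → rw D ⊢* α ↦ rw (drop 1 D) , α ++ top D
⊢*-rw {α} [] p = subst ([] ⊢* α ↦ [] ,_) (sym (List.++-identityʳ α)) []
⊢*-rw {α} (row {d} {D} n s c t) p =
  subst₂ (_⊢* α ↦_, α ++ d) (sym (rw-∷ d D)) (rw-tail D)
    (⊢*-++ (⊢*-rw t (All.map (All.++⁻ʳ d) p))
      (⊢*-skip (All.map (All.++⁻ˡ d) p)
        (subst₂ (d ⊢*_↦ top D ,_) (List.++-identityʳ _) (List.++-identityʳ d) (⊢*-push c s (inj₂ refl)))))

-- Juxtaposition

infixl 6 _∥_
_∥_ : Tableau → Tableau → Tableau
[]      ∥ D       = D
(α ∷ A) ∥ []      = α ∷ A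
(α ∷ A) ∥ (d ∷ D) = (α ++ d) ∷ (A ∥ D)

∥-identityʳ : ∀ A → A ∥ [] ≡ A
∥-identityʳ []      = refl
∥-identityʳ (_ ∷ _) = refl

data Beside : Tableau → Tableau → Set where
  noneˡ : ∀ {D} → Beside [] D
  noneʳ : ∀ {A} → Beside A []
  _∷_   : ∀ {α A d D} → α ≼ concat (d ∷ D) → Beside A D → Beside (α ∷ A) (d ∷ D)

≼⇒Beside : ∀ {A D} → concat A ≼ concat D → Beside A D
≼⇒Beside {[]}            p = noneˡ
≼⇒Beside {_ ∷ _} {[]}    p = noneʳ
≼⇒Beside {α ∷ A} {d ∷ D} p =
  All.++⁻ˡ α p ∷ ≼⇒Beside (All.map (All.++⁻ʳ d) (All.++⁻ʳ α p))

·-∥ : ∀ {A D} → Tab D → Beside A D → A · D ≡ A ∥ D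
·-∥ [] noneˡ = refl
·-∥ (row {[]} () _ _ _) noneˡ
·-∥ t@(row {x ∷ d} {D} n s c t′) noneˡ = begin
  [] ◁ rw ((x ∷ d) ∷ D)         ≡⟨ cong ([] ◁_) (rw-∷ (x ∷ d) D) ⟩
  [] ◁ (rw D ++ x ∷ d)          ≡⟨ empty-row (rw D) ⟩
  ([] ∷ []) ◁ (rw D ++ x ∷ d)   ≡⟨ cong (([] ∷ []) ◁_) (rw-∷ (x ∷ d) D) ⟨
  ([] ∷ []) ◁ rw ((x ∷ d) ∷ D)  ≡⟨ ◁-∷ [] (⊢*-rw t []) ⟩
  (x ∷ d) ∷ [] · D              ≡⟨ cong ((x ∷ d) ∷_) (·-∥ t′ noneˡ) ⟩
  (x ∷ d) ∷ D                   ∎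
  where
  open ≡-Reasoning
  -- A single empty row replaces the empty tableau so that `◁-∷` applies; the first inserted letter
  -- makes the two indistinguishable.
  empty-row : ∀ v {x w} → [] ◁ (v ++ x ∷ w) ≡ ([] ∷ []) ◁ (v ++ x ∷ w)
  empty-row []      = refl
  empty-row (_ ∷ _) = refl
·-∥ {A} t noneʳ = sym (∥-identityʳ A)
·-∥ t@(row _ _ _ t′) (p ∷ b) = trans (◁-∷ _ (⊢*-rw t p)) (cong (_ ∷_) (·-∥ t′ b))

·-identityˡ : ∀ {T} → Tab T → [] · T ≡ T
·-identityˡ t = ·-∥ t noneˡ

Tab-++⁻ʳ : ∀ X {Y} → Tab (X ++ Y) → Tab Y
Tab-++⁻ʳ []      t             = t
Tab-++⁻ʳ (_ ∷ X) (row _ _ _ t) = Tab-++⁻ʳ X t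

Tab-++⁻ˡ : ∀ X {Y} → Tab (X ++ Y) → Tab X
Tab-++⁻ˡ []          t             = []
Tab-++⁻ˡ (_ ∷ [])    (row n s c t) = row n s tt []
Tab-++⁻ˡ (_ ∷ x ∷ X) (row n s c t) = row n s c (Tab-++⁻ˡ (x ∷ X) t)

·-stack : ∀ X {Y} → Tab (X ++ Y) → Y · X ≡ X ++ Y
·-stack X {Y} t = begin
  Y ◁ rw X              ≡⟨ cong (_◁ rw X) (·-identityˡ (Tab-++⁻ʳ X t)) ⟨
  [] ◁ rw Y ◁ rw X      ≡⟨ ◁-++ [] (rw Y) (rw X) ⟨
  [] ◁ (rw Y ++ rw X)   ≡⟨ cong ([] ◁_) (rw-++ X Y) ⟨
  [] · (X ++ Y)         ≡⟨ ·-identityˡ t ⟩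
  X ++ Y                ∎
  where open ≡-Reasoning

-- Strengthens `Beside`: a row of `A` that faces a row of `D` has exactly `b` cells, so that `D`
-- occupies precisely the columns of `A ∥ D` beyond `b`. If `D` may outlast `A`, this leaves only
-- `b ≡ 0`.
data Side (b : ℕ) : Tableau → Tableau → Set where
  noneˡ : ∀ {D} → b ≡ 0 → Side b [] D
  noneʳ : ∀ {A} → Side b A []
  row   : ∀ {α A d D} → length α ≡ b → α ≼ concat (d ∷ D) → Side b A D → Side b (α ∷ A) (d ∷ D)

Side⇒Beside : ∀ {b A D} → Side b A D → Beside A D
Side⇒Beside (noneˡ _)   = noneˡ
Side⇒Beside noneʳ       = noneʳ
Side⇒Beside (row _ p s) = p ∷ Side⇒Beside s

Side-shift : ∀ {b A d D} → Side b A (d ∷ D) → Side b A D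
Side-shift (noneˡ e) = noneˡ e
Side-shift {D = []}    (row e p s) = noneʳ
Side-shift {D = _ ∷ _} (row {d = d} e p s) = row e (All.map (All.++⁻ʳ d) p) (Side-shift s)

-- The new top row lifts `D` by one row relative to `A`, so each row of `A` now faces the next lower
-- row of `D`, if any; `Side-shift` accounts for this.
Side-∷ : ∀ {b ρ A D} → length ρ ≡ b → ρ ≼ concat D → Side b A D → Side b (ρ ∷ A) D
Side-∷ {D = []}    e p s = noneʳ
Side-∷ {D = _ ∷ _} e p s = row e p (Side-shift s)

Rect : ℕ → Tableau → Set
Rect b = All (λ r → length r ≡ b)

Side-rect : ∀ {b R E} A → Rect b R → length E ≤ length R → concat R ≼ concat E → Side b (R ++ A) E
Side-rect {E = []} A rs l p = noneʳ
Side-rect {R = ρ ∷ R} {E = e ∷ E} A (r ∷ rs) (s≤s l) p =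
  row r (All.++⁻ˡ ρ p) (Side-rect A rs l (All.map (All.++⁻ʳ e) (All.++⁻ʳ ρ p)))

-- `ρ` bumps exactly the first `b` entries of the top row, and these do the same to the next row.
-- The cells beyond column `b` never move.
∥-◁-row : ∀ {b ρ A D} → Side b A D → Tab (ρ ∷ A) → length ρ ≡ b → (A ∥ D) ◁ ρ ≡ (ρ ∷ A) ∥ D
∥-◁-row (noneˡ refl) (row {[]}    () _ _ _) e
∥-◁-row (noneˡ refl) (row {_ ∷ _} _  _ _ _) ()
∥-◁-row {ρ = ρ} (noneʳ {A}) t e rewrite ∥-identityʳ A =
  trans (cong (A ◁_) (sym (List.++-identityʳ ρ))) (·-stack (ρ ∷ []) t)
∥-◁-row {ρ = ρ} {α ∷ A} {d ∷ D} (row e′ p s) (row _ so c t) e =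
  trans (◁-∷ (A ∥ D) (⊢*-push c so (inj₁ (trans e (sym e′))))) (cong ((ρ ++ d) ∷_) (∥-◁-row s t e′))

∥-·-rect : ∀ {b T A D} → Tab (T ++ A) → Rect b T → concat T ≼ concat D → Side b A D →
  Side b (T ++ A) D × (A ∥ D) · T ≡ (T ++ A) ∥ D
∥-·-rect {T = []} t [] p s = s , refl
∥-·-rect {T = τ ∷ T} {A} {D} t@(row _ _ _ t′) (e ∷ es) p s
  with ∥-·-rect t′ es (All.++⁻ʳ τ p) s
... | s′ , eq = Side-∷ e (All.++⁻ˡ τ p) s′ , (begin
  (A ∥ D) ◁ rw (τ ∷ T)       ≡⟨ cong ((A ∥ D) ◁_) (rw-∷ τ T) ⟩
  (A ∥ D) ◁ (rw T ++ τ)      ≡⟨ ◁-++ (A ∥ D) (rw T) τ ⟩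
  (A ∥ D) · T ◁ τ            ≡⟨ cong (_◁ τ) eq ⟩
  ((T ++ A) ∥ D) ◁ τ         ≡⟨ ∥-◁-row s′ t e ⟩
  (τ ∷ T ++ A) ∥ D           ∎)
  where open ≡-Reasoning

-- Columns

left right : ℕ → Tableau → Tableau
left  b W = dropEmpty (map (take b) W)
right b W = dropEmpty (map (drop b) W)

Narrow : ℕ → Tableau → Set
Narrow b = All (λ r → length r ≤ b)

dropEmpty-∷ : ∀ {r} R → NonEmptyRow r → dropEmpty (r ∷ R) ≡ r ∷ dropEmpty R
dropEmpty-∷ {_ ∷ _} R n = refl

Tab⇒nonempty : ∀ {T} → Tab T → All NonEmptyRow T
Tab⇒nonempty t = proj₁ (Tab⇒IsTableau t)

left-0 : ∀ W → left 0 W ≡ []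
left-0 []      = refl
left-0 (_ ∷ W) = left-0 W

right-0 : ∀ {W} → Tab W → right 0 W ≡ W
right-0 []            = refl
right-0 (row {r} {R} n _ _ t) = trans (dropEmpty-∷ (map (drop 0) R) n) (cong (r ∷_) (right-0 t))

ColStrict-take : ∀ b {r s} → ColStrict r s → ColStrict (take b r) (take b s)
ColStrict-take zero    c = tt
ColStrict-take (suc b) {_}     {[]}    c       = tt
ColStrict-take (suc b) {_ ∷ _} {_ ∷ _} (p , c) = p , ColStrict-take b c

ColStrict-drop : ∀ b {r s} → ColStrict r s → ColStrict (drop b r) (drop b s)
ColStrict-drop zero    c = c
ColStrict-drop (suc b) {_}     {[]}    c       = tt
ColStrict-drop (suc b) {_ ∷ _} {_ ∷ _} (p , c) = ColStrict-drop b c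

Sorted-++⁻ : ∀ v {w} → Sorted (v ++ w) → Sorted v × Sorted w × v ≼ w
Sorted-++⁻ []      s = [] , s , []
Sorted-++⁻ (x ∷ v) s with Sorted-++⁻ v (Linked.tail s)
... | s₁ , s₂ , p =
  sorted-∷ (All.++⁻ˡ v (sorted-head s)) s₁ , s₂ , All.++⁻ʳ v (sorted-head s) ∷ p

Sorted-split : ∀ b {r} → Sorted r → Sorted (take b r) × Sorted (drop b r) × take b r ≼ drop b r
Sorted-split b {r} s = Sorted-++⁻ (take b r) (subst Sorted (sym (List.take++drop≡id b r)) s)

left-∷ : ∀ {b r} R → NonEmptyRow r → left (suc b) (r ∷ R) ≡ take (suc b) r ∷ left (suc b) R
left-∷ {r = _ ∷ _} R n = refl

top-left : ∀ {b R} → Tab R → top (left (suc b) R) ≡ take (suc b) (top R)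
top-left []                      = refl
top-left {b} (row {R = R} n _ _ _) = cong top (left-∷ {b} R n)

left-Tab : ∀ b {W} → Tab W → Tab (left b W)
left-Tab zero {W} t rewrite left-0 W = []
left-Tab (suc b) [] = []
left-Tab (suc b) (row {r@(x ∷ r′)} {R} n s c t) =
  row (s≤s z≤n) (proj₁ (Sorted-split (suc b) s))
    (subst (ColStrict (take (suc b) r)) (sym (top-left t)) (ColStrict-take (suc b) {r} c)) (left-Tab (suc b) t)

left-narrow : ∀ b W → Narrow b (left b W)
left-narrow b W = All.filter⁺ _ (All.map⁺ (All.universal (λ r → ℕ.≤-trans (ℕ.≤-reflexive (List.length-take b r)) (ℕ.m⊓n≤m b (length r))) W))

right-∷ : ∀ b {r R} → Tab (r ∷ R) →
  (drop b r ≡ [] × right b (r ∷ R) ≡ [] × right b R ≡ []) ⊎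
  (NonEmptyRow (drop b r) × right b (r ∷ R) ≡ drop b r ∷ right b R)
right-∷ b {r} {R} t with drop b r in eq
... | _ ∷ _ = inj₂ (s≤s z≤n , refl)
... | []    = inj₁ (refl , vanish R t eq , vanish R t eq)
  where
  vanish : ∀ {r} R → Tab (r ∷ R) → drop b r ≡ [] → right b R ≡ []
  vanish [] _ _ = refl
  vanish {r} (s ∷ R) (row _ _ c t) e with drop b s in eq | ColStrict-drop b {r} {s} c
  ... | []    | _  = vanish R t eq
  ... | _ ∷ _ | c′ rewrite e = ⊥-elim c′

top-right : ∀ b {R} → Tab R → top (right b R) ≡ drop b (top R)
top-right zero    []  = refl
top-right (suc b) []  = refl
top-right b t@(row _ _ _ _) with right-∷ b t
... | inj₁ (e , e′ , _) = trans (cong top e′) (sym e)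
... | inj₂ (_ , e)  = cong top e

right-Tab : ∀ b {W} → Tab W → Tab (right b W)
right-Tab b [] = []
right-Tab b t@(row {r} n s c t′) with right-∷ b t
... | inj₁ (_ , e , _) = subst Tab (sym e) []
... | inj₂ (n′ , e) = subst Tab (sym e)
  (row n′ (proj₁ (proj₂ (Sorted-split b s)))
    (subst (ColStrict (drop b r)) (sym (top-right b t′)) (ColStrict-drop b {r} c)) (right-Tab b t′))

ColStrict-All : ∀ {x} r s → ColStrict r s → All (x ℤ.≤_) r → All (x ℤ.≤_) s
ColStrict-All _       []      _       _        = []
ColStrict-All (_ ∷ r) (_ ∷ s) (p , c) (q ∷ qs) = ℤ.≤-trans q (ℤ.<⇒≤ p) ∷ ColStrict-All r s c qs

Tab-All : ∀ {x T} → Tab T → All (x ℤ.≤_) (top T) → All (x ℤ.≤_) (concat T)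
Tab-All [] p = []
Tab-All (row {r} {R} _ _ c t) p = All.++⁺ p (Tab-All t (ColStrict-All r (top R) c p))

length-take-drop : ∀ b r → NonEmptyRow (drop b r) → length (take b r) ≡ b
length-take-drop zero    r       n = refl
length-take-drop (suc b) (_ ∷ r) n = cong suc (length-take-drop b r n)

take-drop-[] : ∀ b (r : Row) → drop b r ≡ [] → take b r ≡ r
take-drop-[] b r e = begin
  take b r              ≡⟨ List.++-identityʳ _ ⟨
  take b r ++ []        ≡⟨ cong (take b r ++_) e ⟨
  take b r ++ drop b r  ≡⟨ List.take++drop≡id b r ⟩
  r                     ∎
  where open ≡-Reasoning

left-right : ∀ b {W} → Tab W → Side b (left b W) (right b W) × left b W ∥ right b W ≡ W
left-right zero {W} t rewrite left-0 W | right-0 t = noneˡ refl , refl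
left-right (suc b) [] = noneʳ , refl
left-right (suc b) t@(row {r} {R} n s c t′)
  with right-∷ (suc b) t | left-right (suc b) t′
... | inj₂ (n′ , e) | s′ , eq =
  subst₂ (λ A D → Side (suc b) A D × A ∥ D ≡ r ∷ R) (sym (left-∷ {b} R n)) (sym e)
    ( row (length-take-drop (suc b) r n′)
        (All.map (Tab-All (subst Tab e (right-Tab (suc b) t))) (proj₂ (proj₂ (Sorted-split (suc b) s)))) s′
    , cong₂ _∷_ (List.take++drop≡id (suc b) r) eq)
... | inj₁ (e , e′ , e″) | _ , eq =
  subst₂ (λ A D → Side (suc b) A D × A ∥ D ≡ r ∷ R) (sym (left-∷ {b} R n)) (sym e′)
    (noneʳ , cong₂ _∷_ (take-drop-[] (suc b) r e)
      (trans (sym (∥-identityʳ _)) (trans (cong (left (suc b) R ∥_) (sym e″)) eq)))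

take-exact : ∀ {A : Set} {b} (α : List A) {d} → length α ≡ b → take b (α ++ d) ≡ α
take-exact []      refl = refl
take-exact (x ∷ α) refl = cong (x ∷_) (take-exact α refl)

drop-exact : ∀ {A : Set} {b} (α : List A) {d} → length α ≡ b → drop b (α ++ d) ≡ d
drop-exact []      refl = refl
drop-exact (x ∷ α) refl = drop-exact α refl

left-id : ∀ {b A} → All NonEmptyRow A → Narrow b A → left b A ≡ A
left-id [] [] = refl
left-id {b} {r ∷ A} (n ∷ ns) (p ∷ ps) rewrite List.take-all b r p =
  trans (dropEmpty-∷ (map (take b) A) n) (cong (r ∷_) (left-id ns ps))

right-[] : ∀ {b A} → Narrow b A → right b A ≡ []
right-[] [] = refl
right-[] {b} {r ∷ A} (p ∷ ps) rewrite List.drop-all b r p = right-[] ps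

left-∥ : ∀ {b A D} → Side b A D → All NonEmptyRow A → Narrow b A → left b (A ∥ D) ≡ A
left-∥ (noneˡ {D} refl) _ _ = left-0 D
left-∥ (noneʳ {A}) n p rewrite ∥-identityʳ A = left-id n p
left-∥ {b} (row {α} {A} {d} {D} e _ s) (n ∷ ns) (_ ∷ ps) rewrite take-exact α {d} e =
  trans (dropEmpty-∷ (map (take b) (A ∥ D)) n) (cong (α ∷_) (left-∥ s ns ps))

right-∥ : ∀ {b A D} → Side b A D → Tab D → Narrow b A → right b (A ∥ D) ≡ D
right-∥ (noneˡ refl) t _ = right-0 t
right-∥ (noneʳ {A}) _ p rewrite ∥-identityʳ A = right-[] p
right-∥ {b} (row {α} {A} {d} {D} e _ s) (row n _ _ t) (_ ∷ ps) rewrite drop-exact α {d} e =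
  trans (dropEmpty-∷ (map (drop b) (A ∥ D)) n) (cong (d ∷_) (right-∥ s t ps))

take-Tab : ∀ a {W} → Tab W → Tab (take a W)
take-Tab a {W} t = Tab-++⁻ˡ (take a W) (subst Tab (sym (List.take++drop≡id a W)) t)

drop-Tab : ∀ a {W} → Tab W → Tab (drop a W)
drop-Tab a {W} t = Tab-++⁻ʳ (take a W) (subst Tab (sym (List.take++drop≡id a W)) t)

drop-·-take : ∀ a {W} → Tab W → drop a W · take a W ≡ W
drop-·-take a {W} t =
  trans (·-stack (take a W) (subst Tab (sym (List.take++drop≡id a W)) t)) (List.take++drop≡id a W)

left-·-right : ∀ b {W} → Tab W → left b W · right b W ≡ W
left-·-right b t =
  trans (·-∥ (right-Tab b t) (Side⇒Beside (proj₁ (left-right b t)))) (proj₂ (left-right b t))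

take-◁ : ∀ a R w → take a (R ◁ w) ≡ take a (take a R ◁ w)
take-◁ zero    R       w = refl
take-◁ (suc a) []      w = refl
take-◁ (suc a) (r ∷ R) w with ⊢*-total w r
... | u , r′ , i rewrite ◁-∷ R i | ◁-∷ (take a R) i = cong (r′ ∷_) (take-◁ a R u)

-- The word bumped out of the first `a` rows depends on those rows alone. The tableau it builds by
-- itself is `drop a (take a R ◁ w)`, and the lower rows of `R` react only to its Knuth class.
drop-◁ : ∀ a {R} w → Tab R → drop a (R ◁ w) ≡ drop a R · drop a (take a R ◁ w)
drop-◁ zero    w t  = sym (◁-≈ t (rw-◁ w []))
drop-◁ (suc a) w [] = sym (·-identityˡ (drop-Tab (suc a) (◁-Tab w [])))
drop-◁ (suc a) w (row {r} {R} _ _ _ t) with ⊢*-total w r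
... | u , r′ , i rewrite ◁-∷ R i | ◁-∷ (take a R) i = drop-◁ a u t

module _ {p : ℤ → Set} where

  ·-All⁺ : ∀ {X} Y → Tab X → All p (concat X) → All p (concat Y) → All p (concat (X · Y))
  ·-All⁺ Y t ps qs = Perm.All-resp-↭ (↭-sym (concat-·-↭ Y t)) (All.++⁺ ps qs)

  ·-All⁻ : ∀ {X} Y → Tab X → All p (concat (X · Y)) → All p (concat X) × All p (concat Y)
  ·-All⁻ {X} Y t ps = All.++⁻ (concat X) (Perm.All-resp-↭ (concat-·-↭ Y t) ps)

  left-All : ∀ b {W} → Tab W → All p (concat W) → All p (concat (left b W))
  left-All b {W} t ps =
    proj₁ (·-All⁻ (right b W) (left-Tab b t) (subst (All p ∘ concat) (sym (left-·-right b t)) ps))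

  right-All : ∀ b {W} → Tab W → All p (concat W) → All p (concat (right b W))
  right-All b {W} t ps =
    proj₂ (·-All⁻ (right b W) (left-Tab b t) (subst (All p ∘ concat) (sym (left-·-right b t)) ps))

≺-swap : ∀ {v w} → All (λ y → All (ℤ._< y) v) w → v ≺ w
≺-swap {[]}    ps = []
≺-swap {_ ∷ _} ps = All.map All.head ps ∷ ≺-swap (All.map All.tail ps)

≺-swap⁻ : ∀ {v w} → v ≺ w → All (λ y → All (ℤ._< y) v) w
≺-swap⁻ {w = []}    ps = []
≺-swap⁻ {w = _ ∷ _} ps = All.map All.head ps ∷ ≺-swap⁻ (All.map All.tail ps)

ColStrict-≺ : ∀ r s → length s ≤ length r → r ≺ s → ColStrict r s
ColStrict-≺ _       []      l p        = tt
ColStrict-≺ (_ ∷ r) (_ ∷ s) (s≤s l) ((p ∷ _) ∷ ps) = p , ColStrict-≺ r s l (All.map All.tail ps)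

top-≺ : ∀ {v} A → v ≺ concat A → v ≺ top A
top-≺ []      p = p
top-≺ (α ∷ A) p = All.map (All.++⁻ˡ α) p

top-narrow : ∀ {b A} → Narrow b A → length (top A) ≤ b
top-narrow []      = z≤n
top-narrow (p ∷ _) = p

-- Passing small rectangles, and the columns of a product

Tab-rect-++ : ∀ {b R A} → Tab R → Rect b R → Tab A → Narrow b A → concat R ≺ concat A → Tab (R ++ A)
Tab-rect-++ [] _ t _ _ = t
Tab-rect-++ {A = A} (row {ρ} n s c []) (e ∷ _) t k p =
  row n s (ColStrict-≺ ρ (top A) (subst (length (top A) ≤_) (sym e) (top-narrow k)) (top-≺ A (All.++⁻ˡ ρ p))) t
Tab-rect-++ (row {ρ} n s c r@(row _ _ _ _)) (_ ∷ es) t k p =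
  row n s c (Tab-rect-++ r es t k (All.++⁻ʳ ρ p))

-- Inserting `R` pushes the columns `A` down and leaves `D` in place, which is also the result of
-- inserting `R` before `D`. In this way `D` and `R` change places to the right of `A`.
rect-pass : ∀ {b A D R} → Tab A → Narrow b A → Tab D → Side b A D →
  Tab R → Rect b R → concat R ≺ concat A → concat R ≺ concat D →
  Tab (R ++ A) × Side b (R ++ A) D × A · R ≡ R ++ A ×
  (A ∥ D) · R ≡ (R ++ A) ∥ D × (A ∥ D) · R ≡ A · R · D
rect-pass {b} {A} {D} {R} tA nA tD s tR e p q
  with Tab-rect-++ tR e tA nA p
... | tRA with ∥-·-rect tRA e (≺⇒≼ q) s
...   | s′ , eq =
  tRA , s′ , ·-stack R tRA , eq ,
  trans eq (trans (sym (·-∥ tD (Side⇒Beside s′))) (cong (_· D) (sym (·-stack R tRA))))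

lower-bound : ∀ w → ∃ λ z → All (z ℤ.<_) w
lower-bound [] = ℤ.+ 0 , []
lower-bound (x ∷ w) with lower-bound w
... | z , p = ℤ.pred (x ℤ.⊓ z) ,
  ℤ.<-≤-trans (ℤ.i≤pred[j]⇒i<j ℤ.≤-refl) (ℤ.i⊓j≤i x z) ∷
  All.map (ℤ.<-trans (ℤ.<-≤-trans (ℤ.i≤pred[j]⇒i<j ℤ.≤-refl) (ℤ.i⊓j≤j x z))) p

small-rectangle : ∀ b N w → ∃ λ R → length R ≡ N × Tab R × Rect (suc b) R × concat R ≺ w
small-rectangle b zero    w = [] , refl , [] , [] , []
small-rectangle b (suc N) w with small-rectangle b N w
... | R , l , t , e , p with lower-bound (concat R ++ w)
...   | z , q = ρ ∷ R , cong suc l ,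
  row (s≤s z≤n) (constant (suc b)) (ColStrict-≺ ρ (top R) below (top-≺ R (replicate⁺ (All.++⁻ˡ (concat R) q)))) t ,
  List.length-replicate (suc b) ∷ e ,
  All.++⁺ (replicate⁺ (All.++⁻ʳ (concat R) q)) p
  where
  ρ : Row
  ρ = replicate (suc b) z
  replicate⁺ : ∀ {p : ℤ → Set} → p z → All p ρ
  replicate⁺ = All.replicate⁺ (suc b)
  constant : ∀ k → Sorted (replicate k z)
  constant zero    = []
  constant (suc k) = sorted-∷ (All.replicate⁺ k ℤ.≤-refl) (constant k)
  below : length (top R) ≤ length ρ
  below = subst (length (top R) ≤_) (sym (List.length-replicate (suc b)))
    (top-narrow (All.map ℕ.≤-reflexive e))

-- Multiplying on the right by a large rectangle of small entries and b columns pushes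
-- the first b columns down and leaves the others in place, which identifies the columns.
·-columns : ∀ b {P Q} → Tab P → Tab Q →
  left b (P · Q) ≡ left b (P · left b Q) × right b (P · Q) ≡ right b (P · left b Q) · right b Q
·-columns zero {P} {Q} tP tQ rewrite left-0 Q | left-0 (P · Q) | left-0 P
  | right-0 tP | right-0 tQ | right-0 (·-Tab Q tP) = refl , refl
·-columns (suc b₀) {P} {Q} tP tQ = List.++-cancelˡ R A″ A′ eqA , eqD
  where
  open ≡-Reasoning
  b = suc b₀
  A = left b Q
  D = right b Q
  A′ = left b (P · A)
  D′ = right b (P · A)
  V = P · Q
  A″ = left b V
  D″ = right b V
  tA = left-Tab b tQ
  tD = right-Tab b tQ
  tPA : Tab (P · A)
  tPA = ·-Tab A tP
  tA′ = left-Tab b tPA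
  tD′ = right-Tab b tPA
  tV : Tab V
  tV = ·-Tab Q tP
  tE : Tab (D′ · D)
  tE = ·-Tab D tD′
  -- The height makes `D′ · D` fit beside `R` alone, whatever stands below `R`. Entries below those
  -- of `V` are below those of every factor, since products only permute entries.
  rectangle = small-rectangle b₀ (length (D′ · D)) (concat V)
  R = proj₁ rectangle
  lR = proj₁ (proj₂ rectangle)
  tR = proj₁ (proj₂ (proj₂ rectangle))
  eR = proj₁ (proj₂ (proj₂ (proj₂ rectangle)))
  small = All (λ y → All (ℤ._< y) (concat R))
  ps : small (concat V)
  ps = ≺-swap⁻ (proj₂ (proj₂ (proj₂ (proj₂ rectangle))))
  pP : small (concat P)
  pP = proj₁ (·-All⁻ Q tP ps)
  pQ : small (concat Q)
  pQ = proj₂ (·-All⁻ Q tP ps)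
  pA = left-All b tQ pQ
  pD = right-All b tQ pQ
  pPA : small (concat (P · A))
  pPA = ·-All⁺ A tP pP pA
  pA′ = left-All b tPA pPA
  pD′ = right-All b tPA pPA
  passQ = rect-pass tA (left-narrow b Q) tD (proj₁ (left-right b tQ)) tR eR (≺-swap pA) (≺-swap pD)
  passPA = rect-pass tA′ (left-narrow b (P · A)) tD′ (proj₁ (left-right b tPA)) tR eR (≺-swap pA′) (≺-swap pD′)
  passV = rect-pass (left-Tab b tV) (left-narrow b V) (right-Tab b tV) (proj₁ (left-right b tV)) tR eR
    (≺-swap (left-All b tV ps)) (≺-swap (right-All b tV ps))
  side : Side b (R ++ A′) (D′ · D)
  side = Side-rect A′ eR (ℕ.≤-reflexive (sym lR)) (≺⇒≼ (≺-swap (·-All⁺ D tD′ pD′ pD)))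
  eq : (R ++ A″) ∥ D″ ≡ (R ++ A′) ∥ (D′ · D)
  eq = begin
    (R ++ A″) ∥ D″        ≡⟨ proj₁ (proj₂ (proj₂ (proj₂ passV))) ⟨
    (A″ ∥ D″) · R         ≡⟨ cong (_· R) (proj₂ (left-right b tV)) ⟩
    P · Q · R             ≡⟨ ·-assoc R tP tQ ⟩
    P · (Q · R)           ≡⟨ cong (λ X → P · (X · R)) (proj₂ (left-right b tQ)) ⟨
    P · ((A ∥ D) · R)     ≡⟨ cong (P ·_) (proj₂ (proj₂ (proj₂ (proj₂ passQ)))) ⟩
    P · (A · R · D)       ≡⟨ ·-assoc D tP (·-Tab R tA) ⟨
    P · (A · R) · D       ≡⟨ cong (_· D) (·-assoc R tP tA) ⟨
    P · A · R · D         ≡⟨ cong (λ X → X · R · D) (proj₂ (left-right b tPA)) ⟨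
    (A′ ∥ D′) · R · D     ≡⟨ cong (_· D) (proj₂ (proj₂ (proj₂ (proj₂ passPA)))) ⟩
    A′ · R · D′ · D       ≡⟨ cong (λ X → X · D′ · D) (proj₁ (proj₂ (proj₂ passPA))) ⟩
    (R ++ A′) · D′ · D    ≡⟨ ·-assoc D (proj₁ passPA) tD′ ⟩
    (R ++ A′) · (D′ · D)  ≡⟨ ·-∥ tE (Side⇒Beside side) ⟩
    (R ++ A′) ∥ (D′ · D)  ∎
  narrow : ∀ {X} → Narrow b X → Narrow b (R ++ X)
  narrow n = All.++⁺ (All.map ℕ.≤-reflexive eR) n
  eqA : R ++ A″ ≡ R ++ A′
  eqA = trans (sym (left-∥ (proj₁ (proj₂ passV)) (Tab⇒nonempty (proj₁ passV)) (narrow (left-narrow b V))))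
    (trans (cong (left b) eq) (left-∥ side (Tab⇒nonempty (proj₁ passPA)) (narrow (left-narrow b (P · A)))))
  eqD : D″ ≡ D′ · D
  eqD = trans (sym (right-∥ (proj₁ (proj₂ passV)) (right-Tab b tV) (narrow (left-narrow b V))))
    (trans (cong (right b) eq) (right-∥ side tE (narrow (left-narrow b (P · A)))))

drop-++-≤ : ∀ {A : Set} {b} (α : List A) {d} → b ≤ length α → drop b (α ++ d) ≡ drop b α ++ d
drop-++-≤ {b = zero}  α       l       = refl
drop-++-≤ {b = suc _} (_ ∷ α) (s≤s l) = drop-++-≤ α l

take-++-≤ : ∀ {A : Set} {b} (α : List A) {d} → b ≤ length α → take b (α ++ d) ≡ take b α
take-++-≤ {b = zero}  α       l       = refl
take-++-≤ {b = suc _} (x ∷ α) (s≤s l) = cong (x ∷_) (take-++-≤ α l)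

dropEmpty-cong : ∀ r {R S} → dropEmpty R ≡ dropEmpty S → dropEmpty (r ∷ R) ≡ dropEmpty (r ∷ S)
dropEmpty-cong []      e = e
dropEmpty-cong (x ∷ r) e = cong ((x ∷ r) ∷_) e

left-∥-≤ : ∀ {b c A D} → b ≤ c → Side c A D → left b (A ∥ D) ≡ left b A
left-∥-≤ {b} l (noneˡ {D} e) rewrite ℕ.n≤0⇒n≡0 (subst (b ≤_) e l) = left-0 D
left-∥-≤ l (noneʳ {A}) rewrite ∥-identityʳ A = refl
left-∥-≤ {b} l (row {α} {A} {d} {D} refl _ s) rewrite take-++-≤ α {d} l = dropEmpty-cong (take b α) (left-∥-≤ l s)

right-∥-≤ : ∀ {b c A D} → b ≤ c → Tab A → Tab D → Side c A D →
  Beside (right b A) D × right b (A ∥ D) ≡ right b A ∥ D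
right-∥-≤ {b} l _ t (noneˡ e) rewrite ℕ.n≤0⇒n≡0 (subst (b ≤_) e l) = noneˡ , right-0 t
right-∥-≤ {b} l _ _ (noneʳ {A}) rewrite ∥-identityʳ A | ∥-identityʳ (right b A) = noneʳ , refl
right-∥-≤ {b} l tA@(row _ _ _ tA′) (row n _ _ tD) (row {α} {A} {d} {D} refl p s)
  with right-∥-≤ l tA′ tD s | right-∷ b tA
... | _ , eq | inj₁ (e , e′ , e″) rewrite drop-++-≤ α {d} l | e =
  subst (λ X → Beside X (d ∷ D) × dropEmpty (d ∷ map (drop b) (A ∥ D)) ≡ X ∥ (d ∷ D)) (sym e′)
    (noneˡ , trans (dropEmpty-∷ (map (drop b) (A ∥ D)) n) (cong (d ∷_) (trans eq (cong (_∥ D) e″))))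
... | bs , eq | inj₂ (n′ , e) rewrite drop-++-≤ α {d} l =
  subst (λ X → Beside X (d ∷ D) × dropEmpty ((drop b α ++ d) ∷ map (drop b) (A ∥ D)) ≡ X ∥ (d ∷ D)) (sym e)
    (All.drop⁺ b p ∷ bs ,
     trans (dropEmpty-∷ (map (drop b) (A ∥ D)) (ℕ.≤-trans n′ (List.length-++-≤ˡ (drop b α)))) (cong (_ ∷_) eq))

·-conical : ∀ {X Y} → Tab X → Tab Y → X · Y ≡ [] → X ≡ [] × Y ≡ []
·-conical {X} {Y} tX tY e = empty tX (List.++-conicalˡ (concat X) (concat Y) e′) , empty tY (List.++-conicalʳ (concat X) (concat Y) e′)
  where
  e′ : concat X ++ concat Y ≡ []
  e′ = Perm.↭-empty-inv (↭-trans (↭-sym (concat-·-↭ Y tX)) (↭-reflexive (cong concat e)))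
  empty : ∀ {T} → Tab T → concat T ≡ [] → T ≡ []
  empty []                      _  = refl
  empty (row {_ ∷ _} _ _ _ _)   ()
  empty (row {[]}    () _ _ _)  _

-- Rectangular corners

record Corner (a b : ℕ) (T : Tableau) : Set where
  field
    tab    : Tab T
    rows   : Rect b T
    -- A rectangle without columns is the empty tableau, yet `a` still records the row at which a
    -- tableau is cut.
    height : length T ≡ a ⊎ (b ≡ 0 × T ≡ [])

shape⇒Corner : ∀ a b {T} → Tab T → shape T ≡ rect a b → Corner a b T
shape⇒Corner a zero {[]} t e = record { tab = t ; rows = [] ; height = inj₂ (refl , refl) }
shape⇒Corner a (suc b) {T} t e = record
  { tab    = t
  ; rows   = All.map⁻ (subst (All (_≡ suc b)) (sym e) (All.replicate⁺ a refl))
  ; height = inj₁ (trans (sym (List.length-map length T)) (trans (cong length e) (List.length-replicate a)))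
  }

drop-∥ : ∀ T P → drop (length T) (T ∥ P) ≡ drop (length T) P
drop-∥ []      P       = refl
drop-∥ (τ ∷ T) []      = List.drop-all (length T) T ℕ.≤-refl
drop-∥ (τ ∷ T) (_ ∷ P) = drop-∥ T P

take-∥ : ∀ T P → take (length T) (T ∥ P) ≡ T ∥ take (length T) P
take-∥ []      P       = refl
take-∥ (τ ∷ T) []      = cong (τ ∷_) (List.take-all (length T) T ℕ.≤-refl)
take-∥ (τ ∷ T) (p ∷ P) = cong ((τ ++ p) ∷_) (take-∥ T P)

-- First the columns of Q right of the rectangle move past it to the right, then the rows of
-- the resulting right factor below the rectangle move past it to the left.
canonical : ∀ {a b T Q P} → Corner a b T → Tab Q → Tab P → concat T ≺ concat Q → concat T ≺ concat P →
  let P′ = right b Q · P ; W = Q · T · P in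
  drop a W ≡ left b Q · drop a P′ × take a P′ ≡ right b (take a W) × left b (take a W) ≡ T
canonical {a} {b} {T} {Q} {P} C tQ tP TQ TP =
  trans (cong (drop a) W≡) (trans (drop-◁ a (rw P′) tTA) (cong₂ _·_ dropTA (trans (cong (λ X → drop a (X · P′)) takeTA) dropTP))) ,
  trans (sym (right-∥ side (take-Tab a tP′) narrow)) (cong (right b) (sym takeW)) ,
  trans (cong (left b) takeW) (left-∥ side (Tab⇒nonempty tab) narrow)
  where
  open Corner C
  open ≡-Reasoning
  A  = left b Q
  D  = right b Q
  P′ = D · P
  tA : Tab A
  tA = left-Tab b tQ
  tD : Tab D
  tD = right-Tab b tQ
  tP′ : Tab P′
  tP′ = ·-Tab P tD
  qs = ≺-swap⁻ TQ
  ds = right-All b tQ qs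
  pass = rect-pass tA (left-narrow b Q) tD (proj₁ (left-right b tQ)) tab rows
    (≺-swap (left-All b tQ qs)) (≺-swap ds)
  tTA : Tab (T ++ A)
  tTA = proj₁ pass
  TP′ : concat T ≺ concat P′
  TP′ = ≺-swap (·-All⁺ P tD ds (≺-swap⁻ TP))
  -- `T ++ A` is a tableau with `T` in its first `a` rows. Inserting `P′` places its first `a` rows
  -- beside `T` and sends the remaining ones into `A`.
  W≡ : Q · T · P ≡ (T ++ A) · P′
  W≡ = begin
    Q · T · P            ≡⟨ cong (λ X → X · T · P) (proj₂ (left-right b tQ)) ⟨
    (A ∥ D) · T · P      ≡⟨ cong (_· P) (proj₂ (proj₂ (proj₂ (proj₂ pass)))) ⟩
    A · T · D · P        ≡⟨ cong (λ X → X · D · P) (proj₁ (proj₂ (proj₂ pass))) ⟩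
    (T ++ A) · D · P     ≡⟨ ·-assoc P tTA tD ⟩
    (T ++ A) · P′        ∎
  TP≡ : T · P′ ≡ T ∥ P′
  TP≡ = ·-∥ tP′ (≼⇒Beside (≺⇒≼ TP′))
  takeTA : take a (T ++ A) ≡ T
  takeTA with height
  ... | inj₁ e = take-exact T e
  ... | inj₂ (refl , refl) rewrite left-0 Q = List.take-[] a
  dropTA : drop a (T ++ A) ≡ A
  dropTA with height
  ... | inj₁ e = drop-exact T e
  ... | inj₂ (refl , refl) rewrite left-0 Q = List.drop-[] a
  dropTP : drop a (T · P′) ≡ drop a P′
  dropTP with height
  ... | inj₁ refl = trans (cong (drop a) TP≡) (drop-∥ T P′)
  ... | inj₂ (_ , refl) = cong (drop a) TP≡
  takeTP : take a (T · P′) ≡ T ∥ take a P′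
  takeTP with height
  ... | inj₁ refl = trans (cong (take a) TP≡) (take-∥ T P′)
  ... | inj₂ (_ , refl) = cong (take a) TP≡
  takeW : take a (Q · T · P) ≡ T ∥ take a P′
  takeW = begin
    take a (Q · T · P)                ≡⟨ cong (take a) W≡ ⟩
    take a ((T ++ A) · P′)            ≡⟨ take-◁ a (T ++ A) (rw P′) ⟩
    take a (take a (T ++ A) · P′)     ≡⟨ cong (λ X → take a (X · P′)) takeTA ⟩
    take a (T · P′)                   ≡⟨ takeTP ⟩
    T ∥ take a P′                     ∎
  narrow : Narrow b T
  narrow = All.map ℕ.≤-reflexive rows
  side : Side b T (take a P′)
  side with height
  ... | inj₂ (refl , refl) = noneˡ refl
  ... | inj₁ e = subst (λ X → Side b X (take a P′)) (List.++-identityʳ T)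
    (Side-rect [] rows
      (ℕ.≤-trans (ℕ.≤-reflexive (List.length-take a P′)) (ℕ.≤-trans (ℕ.m⊓n≤m a (length P′)) (ℕ.≤-reflexive (sym e))))
      (≺⇒≼ (≺-swap (proj₂ (·-All⁻ (take a P′) (drop-Tab a tP′) (subst (All _ ∘ concat) (sym (drop-·-take a tP′)) (≺-swap⁻ TP′)))))))

-- Cutting one tableau at several rows or columns

dropEmpty-++ : ∀ X Y → dropEmpty (X ++ Y) ≡ dropEmpty X ++ dropEmpty Y
dropEmpty-++ = List.filter-++ _

module _ (f : Row → Row) (a : ℕ) {W : Tableau} (t : Tab (dropEmpty (map f W))) where

  dropEmpty-split : dropEmpty (map f (take a W)) ++ dropEmpty (map f (drop a W)) ≡ dropEmpty (map f W)
  dropEmpty-split = begin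
    dropEmpty (map f (take a W)) ++ dropEmpty (map f (drop a W))  ≡⟨ dropEmpty-++ (map f (take a W)) _ ⟨
    dropEmpty (map f (take a W) ++ map f (drop a W))              ≡⟨ cong dropEmpty (List.map-++ f (take a W) _) ⟨
    dropEmpty (map f (take a W ++ drop a W))                      ≡⟨ cong (dropEmpty ∘ map f) (List.take++drop≡id a W) ⟩
    dropEmpty (map f W)                                           ∎
    where open ≡-Reasoning

  dropEmpty-stack : dropEmpty (map f (drop a W)) · dropEmpty (map f (take a W)) ≡ dropEmpty (map f W)
  dropEmpty-stack = trans (·-stack (dropEmpty (map f (take a W))) (subst Tab (sym dropEmpty-split) t)) dropEmpty-split

left-stack : ∀ a b {W} → Tab W → left b (drop a W) · left b (take a W) ≡ left b W
left-stack a b t = dropEmpty-stack (take b) a (left-Tab b t)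

right-stack : ∀ a b {W} → Tab W → right b (drop a W) · right b (take a W) ≡ right b W
right-stack a b t = dropEmpty-stack (drop b) a (right-Tab b t)

left-left : ∀ {b c W} → b ≤ c → Tab W → left b (left c W) ≡ left b W
left-left {b} {c} l t =
  trans (sym (left-∥-≤ l (proj₁ (left-right c t)))) (cong (left b) (proj₂ (left-right c t)))

-- `right b (left c W)` is the strip between columns `b` and `c`. Hence a right factor of
-- `right c W` is also one of `right b W`: tails pass to narrower corners.
right-right : ∀ {b c W} → b ≤ c → Tab W → right b (left c W) · right c W ≡ right b W
right-right {b} {c} l t with right-∥-≤ l (left-Tab c t) (right-Tab c t) (proj₁ (left-right c t))
... | s , e = trans (·-∥ (right-Tab c t) s) (trans (sym e) (cong (right b) (proj₂ (left-right c t))))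

drop-drop-take : ∀ {a c} W → a ≤ c → Tab W → drop c W · drop a (take c W) ≡ drop a W
drop-drop-take {a} {c} W l t =
  trans (·-stack (drop a (take c W)) (subst Tab (sym e) (drop-Tab a t))) e
  where
  e : drop a (take c W) ++ drop c W ≡ drop a W
  e = split l W
    where
    split : ∀ {a c} → a ≤ c → ∀ (W : Tableau) → drop a (take c W) ++ drop c W ≡ drop a W
    split {c = c} z≤n W = List.take++drop≡id c W
    split (s≤s l) []      = refl
    split (s≤s l) (_ ∷ W) = split l W

open Corner

-- Factor sequences over abstract diagrams

Array : Set
Array = ℕ → ℕ → Tableau

up : {A : Set} → (ℕ → ℕ → A) → ℕ → ℕ → A
up f i j = f i (suc j)

-- Sequences are indexed from 0 here: W i and P i stand for the paper's W_{i+1} and P_{i+1}.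
-- The empty outer factors Q 0 and P m make the two ends of a factor sequence uniform with the rest.
record Links (m : ℕ) (F : (ℕ → Tableau) → Set) (Q P : ℕ → Tableau) : Set where
  field
    first : Q 0 ≡ []
    last  : P m ≡ []
    tabs  : ∀ i → i ≤ m → Tab (Q i) × Tab (P i)
    inner : F (λ i → P i · Q (suc i))
open Links

Factored : ℕ → Array → (W Q P : ℕ → Tableau) → Set
Factored m T W Q P = ∀ i → i ≤ m → W i ≡ Q i · T i (suc i) · P i

-- `FS m` constrains the `m` terms from `W 0` on. Starting with the empty sequence makes the
-- one-term case an instance of the general one: `Q 0` and `P 0` are then both outer factors.
FS : ℕ → Array → (ℕ → Tableau) → Set
FS zero    T W = ⊤
FS (suc m) T W = ∃₂ λ Q P → Links m (FS m (up T)) Q P × Factored m T W Q P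

FS-cong : ∀ m {T W W′} → (∀ i → i < m → W i ≡ W′ i) → FS m T W → FS m T W′
FS-cong zero    e _               = tt
FS-cong (suc m) e (Q , P , l , f) = Q , P , l , λ i p → trans (sym (e i (s≤s p))) (f i p)

Links-cong : ∀ m {T Q P Q′ P′} → (∀ i → i ≤ m → Q i ≡ Q′ i × P i ≡ P′ i) →
  Links m (FS m T) Q P → Links m (FS m T) Q′ P′
Links-cong m e l = record
  { first = trans (sym (proj₁ (e 0 z≤n))) (first l)
  ; last  = trans (sym (proj₂ (e m ℕ.≤-refl))) (last l)
  ; tabs  = λ i p → subst₂ (λ X Y → Tab X × Tab Y) (proj₁ (e i p)) (proj₂ (e i p)) (tabs l i p)
  ; inner = FS-cong m (λ i p → cong₂ _·_ (proj₂ (e i (ℕ.<⇒≤ p))) (proj₁ (e (suc i) p))) (inner l)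
  }

-- Keeps of the rank conditions what the induction uses and what visibly passes to the shifted
-- array: rectangles lose rows as `j` grows and gain columns as `i` grows, both weakly.
record Diagram (n : ℕ) (a b : ℕ → ℕ → ℕ) (T : Array) : Set where
  field
    corner : ∀ {i j} → i < j → j ≤ n → Corner (a i j) (b i j) (T i j)
    a-mono : ∀ {i j} → i < j → j < n → a i (suc j) ≤ a i j
    b-mono : ∀ {i j} → suc i < j → j ≤ n → b i j ≤ b (suc i) j
    order  : ∀ {i j k l} → i < j → j ≤ n → i ≤ k → k < l → l ≤ j → ¬ (k ≡ i × l ≡ j) →
      concat (T k l) ≺ concat (T i j)
open Diagram

Diagram-up : ∀ {n a b T} → Diagram (suc n) a b T → Diagram n (up a) (up b) (up T)
Diagram-up d = record
  { corner = λ p q → corner d (ℕ.m≤n⇒m≤1+n p) (s≤s q)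
  ; a-mono = λ p q → a-mono d (ℕ.m≤n⇒m≤1+n p) (s≤s q)
  ; b-mono = λ p q → b-mono d (ℕ.m≤n⇒m≤1+n p) (s≤s q)
  ; order  = λ p q r s t u → order d (ℕ.m≤n⇒m≤1+n p) (s≤s q) r (ℕ.m≤n⇒m≤1+n s) (s≤s t)
      (λ (v , w) → u (v , ℕ.suc-injective w))
  }

module _ {p : ℤ → Set} where

  -- The entries of `W i` come from the `T k l` with `k ≤ i < l`, and those of `Q i` and `P i` from
  -- such `T k l` other than the corner `T i (suc i)`. By `order` they therefore exceed the entries
  -- of the corner, as `canonical` requires.
  FS-All : ∀ {m a b T W} → Diagram m a b T → FS m T W → ∀ i → i < m →
    (∀ k l → k ≤ i → i < l → l ≤ m → All p (concat (T k l))) → All p (concat (W i))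
  Links-All : ∀ {m a b T Q P} → Diagram (suc m) a b T → Links m (FS m (up T)) Q P → ∀ i → i ≤ m →
    (∀ k l → k ≤ i → i < l → l ≤ suc m → ¬ (k ≡ i × l ≡ suc i) → All p (concat (T k l))) →
    All p (concat (Q i)) × All p (concat (P i))

  FS-All {suc m} {T = T} d (Q , P , l , f) i (s≤s q) h
    with Links-All d l i q (λ k l r s t _ → h k l r s t)
  ... | hQ , hP = subst (All p ∘ concat) (sym (f i q))
    (·-All⁺ (P i) (·-Tab (T i (suc i)) tQ)
      (·-All⁺ (T i (suc i)) tQ hQ (h i (suc i) ℕ.≤-refl ℕ.≤-refl (s≤s q))) hP)
    where tQ = proj₁ (tabs l i q)

  Links-All {m} {T = T} {Q} {P} d L i q h = allQ i q h , allP (ℕ.m≤n⇒m<n∨m≡n q)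
    where
    allQ : ∀ i → i ≤ m → (∀ k l → k ≤ i → i < l → l ≤ suc m → ¬ (k ≡ i × l ≡ suc i) → All p (concat (T k l))) →
      All p (concat (Q i))
    allQ zero    q h = subst (All p ∘ concat) (sym (first L)) []
    allQ (suc i) q h = proj₂ (·-All⁻ (Q (suc i)) (proj₂ (tabs L i (ℕ.<⇒≤ q)))
      (FS-All (Diagram-up d) (inner L) i q
        (λ k l r s t → h k (suc l) (ℕ.m≤n⇒m≤1+n r) (s≤s s) (s≤s t) (λ (e , _) → ℕ.<-irrefl e (s≤s r)))))
    allP : i < m ⊎ i ≡ m → All p (concat (P i))
    allP (inj₂ refl) = subst (All p ∘ concat) (sym (last L)) []
    allP (inj₁ r) = proj₁ (·-All⁻ (Q (suc i)) (proj₂ (tabs L i q))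
      (FS-All (Diagram-up d) (inner L) i r
        (λ k l r s t → h k (suc l) r (ℕ.m≤n⇒m≤1+n s) (s≤s t) (λ (_ , e) → ℕ.<-irrefl (sym (ℕ.suc-injective e)) s))))

-- Transferring tails between neighbouring terms

infix 4 _≗[_]_
_≗[_]_ : (ℕ → Tableau) → ℕ → (ℕ → Tableau) → Set
F ≗[ i ] G = ∀ k → k ≢ i → F k ≡ G k

update : ℕ → Tableau → (ℕ → Tableau) → ℕ → Tableau
update i X F k with k ℕ.≟ i
... | yes _ = X
... | no  _ = F k

update-at : ∀ i X F → update i X F i ≡ X
update-at i X F with i ℕ.≟ i
... | yes _ = refl
... | no ¬e = contradiction refl ¬e

update-off : ∀ i X F → update i X F ≗[ i ] F
update-off i X F k k≢i with k ℕ.≟ i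
... | yes e = contradiction e k≢i
... | no  _ = refl

-- X is a right factor of the columns of W beyond the first c, and Y is what remains of W.
record RightTail (c : ℕ) (W Y X : Tableau) : Set where
  field
    rest    : Tableau
    rest-tab : Tab rest
    X-tab   : Tab X
    Y≡      : Y ≡ left c W · rest
    right≡  : right c W ≡ rest · X

record LeftTail (c : ℕ) (W X Y : Tableau) : Set where
  field
    rest    : Tableau
    rest-tab : Tab rest
    X-tab   : Tab X
    Y≡      : Y ≡ rest · take c W
    drop≡   : drop c W ≡ X · rest

RightTail-Y : ∀ {c W Y X} → Tab W → RightTail c W Y X → Tab Y × W ≡ Y · X
RightTail-Y {c} {W} {Y} {X} t record { rest = B ; rest-tab = tB ; Y≡ = refl ; right≡ = e } =
  ·-Tab B (left-Tab c t) ,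
  trans (sym (left-·-right c t)) (trans (cong (left c W ·_) e) (sym (·-assoc X (left-Tab c t) tB)))

LeftTail-Y : ∀ {c W X Y} → Tab W → LeftTail c W X Y → Tab Y × W ≡ X · Y
LeftTail-Y {c} {W} {X} {Y} t record { rest = B ; rest-tab = tB ; X-tab = tX ; Y≡ = refl ; drop≡ = e } =
  ·-Tab (take c W) tB ,
  trans (sym (drop-·-take c t)) (trans (cong (_· take c W) e) (·-assoc (take c W) tX tB))

-- By `·-columns`, the part of `V · W` beyond column `c` ends in that of `W`, so it keeps every
-- right factor of the latter.
RightTail-· : ∀ {c V W Y X} → Tab V → Tab W → RightTail c W Y X → RightTail c (V · W) (V · Y) X
RightTail-· {c} {V} {W} {Y} {X} tV tW record { rest = B ; rest-tab = tB ; X-tab = tX ; Y≡ = refl ; right≡ = e } = record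
  { rest     = right c (V · A) · B
  ; rest-tab = ·-Tab B tD
  ; X-tab    = tX
  ; Y≡       = begin
      V · (A · B)                                  ≡⟨ ·-assoc B tV tA ⟨
      V · A · B                                    ≡⟨ cong (_· B) (left-·-right c tVA) ⟨
      left c (V · A) · right c (V · A) · B         ≡⟨ ·-assoc B (left-Tab c tVA) tD ⟩
      left c (V · A) · (right c (V · A) · B)       ≡⟨ cong (_· (right c (V · A) · B)) (proj₁ cols) ⟨
      left c (V · W) · (right c (V · A) · B)       ∎
  ; right≡   = trans (proj₂ cols) (trans (cong (right c (V · A) ·_) e) (sym (·-assoc X tD tB)))
  }
  where
  open ≡-Reasoning
  A   = left c W
  tA  = left-Tab c tW
  tVA = ·-Tab A tV
  tD  = right-Tab c tVA
  cols = ·-columns c tV tW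

-- The mirror image of `RightTail-·`, with `drop-◁` in place of `·-columns`.
LeftTail-· : ∀ {c W V X Y} → Tab W → Tab V → LeftTail c W X Y → LeftTail c (W · V) X (Y · V)
LeftTail-· {c} {W} {V} {X} {Y} tW tV record { rest = B ; rest-tab = tB ; X-tab = tX ; Y≡ = refl ; drop≡ = e } = record
  { rest     = B · E
  ; rest-tab = ·-Tab E tB
  ; X-tab    = tX
  ; Y≡       = begin
      B · A · V                          ≡⟨ ·-assoc V tB tA ⟩
      B · (A · V)                        ≡⟨ cong (B ·_) (drop-·-take c tAV) ⟨
      B · (E · take c (A · V))           ≡⟨ ·-assoc (take c (A · V)) tB (drop-Tab c tAV) ⟨
      B · E · take c (A · V)             ≡⟨ cong (B · E ·_) (take-◁ c W (rw V)) ⟨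
      B · E · take c (W · V)             ∎
  ; drop≡    = trans (drop-◁ c (rw V) tW) (trans (cong (_· E) e) (·-assoc E tX tB))
  }
  where
  open ≡-Reasoning
  A   = take c W
  tA  = take-Tab c tW
  tAV : Tab (A · V)
  tAV = ·-Tab V tA
  E   = drop c (A · V)

-- `W′` is given by its values because functions with equal values need not be equal here. At the
-- end of the sequence no neighbour can receive `X`; the last conjunct says that `X` is empty there.
-- The bound `c` will be the size of a corner in the sequence above.
RightTransfer LeftTransfer : ℕ → Set
RightTransfer m = ∀ {a b T W} → Diagram m a b T → FS m T W →
  ∀ {i c Y X} → i < m → b i (suc i) ≤ c → RightTail c (W i) Y X →
  ∀ {W′} → W′ i ≡ Y → W′ (suc i) ≡ X · W (suc i) → (∀ k → k ≢ i → k ≢ suc i → W′ k ≡ W k) →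
  FS m T W′ × (suc i ≡ m → X ≡ [])
LeftTransfer m = ∀ {a b T W} → Diagram m a b T → FS m T W →
  ∀ {i c X Y} → i < m → a i (suc i) ≤ c → LeftTail c (W i) X Y →
  ∀ {W′} → W′ i ≡ Y → (∀ k → suc k ≡ i → W′ k ≡ W k · X) → (∀ k → k ≢ i → suc k ≢ i → W′ k ≡ W k) →
  FS m T W′ × (i ≡ 0 → X ≡ [])

Links-cong-at : ∀ m {T Q P Q′ P′} i → Q i ≡ Q′ i → P i ≡ P′ i → Q′ ≗[ i ] Q → P′ ≗[ i ] P →
  Links m (FS m T) Q P → Links m (FS m T) Q′ P′
Links-cong-at m {Q = Q} {P} {Q′} {P′} i q p qs ps = Links-cong m (λ k _ → agree k)
  where
  agree : ∀ k → Q k ≡ Q′ k × P k ≡ P′ k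
  agree k with k ℕ.≟ i
  ... | yes refl = q , p
  ... | no  ne   = sym (qs k ne) , sym (ps k ne)

Tab-at : ∀ {m Q P Q′ P′} i → Tab (Q′ i) → Tab (P′ i) → Q′ ≗[ i ] Q → P′ ≗[ i ] P →
  (∀ k → k ≤ m → Tab (Q k) × Tab (P k)) → ∀ k → k ≤ m → Tab (Q′ k) × Tab (P′ k)
Tab-at i q p qs ps ts k l with k ℕ.≟ i
... | yes refl = q , p
... | no  ne   = subst Tab (sym (qs k ne)) (proj₁ (ts k l)) , subst Tab (sym (ps k ne)) (proj₂ (ts k l))

-- Moving `X` from `Q (suc i)` to `P (suc i)` takes it off the right end of the inner term `i` and
-- puts it in front of the inner term `suc i`, which is a right transfer one level down. `b-mono`
-- bounds the corner there.
move-right : ∀ {m a b T Q P} → RightTransfer m → Diagram (suc m) a b T → Links m (FS m (up T)) Q P →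
  ∀ {i Y X} → i ≤ m → RightTail (b i (suc i)) (Q i) Y X →
  ∀ {Q′ P′} → Q′ i ≡ Y → P′ i ≡ X · P i → Q′ ≗[ i ] Q → P′ ≗[ i ] P → Links m (FS m (up T)) Q′ P′
move-right {m} {Q = Q} {P} R d L {zero} {Y} {X} i≤m t q p qs ps
  with RightTail-Y (proj₁ (tabs L 0 z≤n)) t
... | tY , e with ·-conical tY (RightTail.X-tab t) (trans (sym e) (first L))
...   | refl , refl = Links-cong-at m 0 (trans (first L) (sym q))
  (sym (trans p (·-identityˡ (proj₂ (tabs L 0 z≤n))))) qs ps L
move-right {m} {Q = Q} {P} R d L {suc i} {Y} {X} i<m t {Q′} {P′} q p qs ps = record
  { first = trans (qs 0 (λ ())) (first L)
  ; last  = last′ (suc i ℕ.≟ m)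
  ; tabs  = Tab-at (suc i) (subst Tab (sym q) (proj₁ (RightTail-Y tQ t))) (subst Tab (sym p) (·-Tab (P (suc i)) tX)) qs ps (tabs L)
  ; inner = proj₁ transfer
  }
  where
  tQ = proj₁ (tabs L (suc i) i<m)
  tP = proj₂ (tabs L i (ℕ.<⇒≤ i<m))
  tP′ = proj₂ (tabs L (suc i) i<m)
  tX = RightTail.X-tab t
  off : ∀ k → k ≢ i → k ≢ suc i → P′ k · Q′ (suc k) ≡ P k · Q (suc k)
  off k k≢i k≢1+i = cong₂ _·_ (ps k k≢1+i) (qs (suc k) (k≢i ∘ ℕ.suc-injective))
  transfer = R (Diagram-up d) (inner L) i<m (b-mono d ℕ.≤-refl (s≤s i<m)) (RightTail-· tP tQ t)
    (cong₂ _·_ (ps i (ℕ.<⇒≢ ℕ.≤-refl)) q)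
    (trans (cong₂ _·_ p (qs (suc (suc i)) (ℕ.>⇒≢ ℕ.≤-refl))) (·-assoc (Q (suc (suc i))) tX tP′)) off
  last′ : Dec (suc i ≡ m) → P′ m ≡ []
  last′ (yes refl) = trans p (cong₂ _·_ (proj₂ transfer refl) (last L))
  last′ (no ne)    = trans (ps m (ne ∘ sym)) (last L)

move-left : ∀ {m a b T Q P} → LeftTransfer m → Diagram (suc m) a b T → Links m (FS m (up T)) Q P →
  ∀ {i X Y} → i ≤ m → LeftTail (a i (suc i)) (P i) X Y →
  ∀ {Q′ P′} → Q′ i ≡ Q i · X → P′ i ≡ Y → Q′ ≗[ i ] Q → P′ ≗[ i ] P → Links m (FS m (up T)) Q′ P′
move-left {m} {T = T} {Q} {P} R d L {i} {X} {Y} i≤m t {Q′} {P′} q p qs ps with ℕ.m≤n⇒m<n∨m≡n i≤m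
... | inj₂ refl with LeftTail-Y (proj₂ (tabs L i i≤m)) t
...   | tY , e with ·-conical (LeftTail.X-tab t) tY (trans (sym e) (last L))
...     | refl , refl = Links-cong-at m i (sym q) (trans (last L) (sym p)) qs ps L
move-left {m} {T = T} {Q} {P} R d L {i} {X} {Y} i≤m t {Q′} {P′} q p qs ps | inj₁ i<m = record
  { first = first′ (0 ℕ.≟ i)
  ; last  = trans (ps m (ℕ.>⇒≢ i<m)) (last L)
  ; tabs  = Tab-at i (subst Tab (sym q) (·-Tab X tQ)) (subst Tab (sym p) (proj₁ (LeftTail-Y tP t))) qs ps (tabs L)
  ; inner = proj₁ transfer
  }
  where
  tQ = proj₁ (tabs L i i≤m)
  tP = proj₂ (tabs L i i≤m)
  before : ∀ k → suc k ≡ i → P′ k · Q′ (suc k) ≡ P k · Q (suc k) · X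
  before k refl = trans (cong₂ _·_ (ps k (ℕ.<⇒≢ ℕ.≤-refl)) q) (sym (·-assoc X (proj₂ (tabs L k (ℕ.<⇒≤ i≤m))) tQ))
  transfer = R (Diagram-up d) (inner L) i<m (a-mono d ℕ.≤-refl (s≤s i<m)) (LeftTail-· tP (proj₁ (tabs L (suc i) i<m)) t)
    (cong₂ _·_ p (qs (suc i) (ℕ.>⇒≢ ℕ.≤-refl))) before
    (λ k k≢i 1+k≢i → cong₂ _·_ (ps k k≢i) (qs (suc k) 1+k≢i))
  first′ : Dec (0 ≡ i) → Q′ 0 ≡ []
  first′ (yes refl) = trans q (cong₂ _·_ (first L) (proj₂ transfer refl))
  first′ (no ne)    = trans (qs 0 ne) (first L)

module _ {m a b T Q P W} (R : RightTransfer m) (R′ : LeftTransfer m)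
  (d : Diagram (suc m) a b T) (L : Links m (FS m (up T)) Q P)
  (i : ℕ) (i≤m : i ≤ m) (W≡ : W ≡ Q i · T i (suc i) · P i)
  where

  private
    aᵢ = a i (suc i)
    bᵢ = b i (suc i)
    Tᵢ = T i (suc i)
    C  = corner d (ℕ.n<1+n i) (s≤s i≤m)
    A  = left bᵢ (Q i)
    D  = right bᵢ (Q i)
    tQ = proj₁ (tabs L i i≤m)
    tP = proj₂ (tabs L i i≤m)
    tA = left-Tab bᵢ tQ
    tD = right-Tab bᵢ tQ
    tDP : Tab (D · P i)
    tDP = ·-Tab (P i) tD
    large = Links-All d L i i≤m
      (λ k l k≤i i<l l≤m ne → ≺-swap⁻ {concat Tᵢ} {concat (T k l)}
        (order d (ℕ.≤-<-trans k≤i i<l) l≤m k≤i (ℕ.n<1+n i) i<l (λ (e , f) → ne (sym e , sym f))))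
    canon = canonical C tQ tP (≺-swap (proj₁ large)) (≺-swap (proj₂ large))

  W-Tab : Tab W
  W-Tab = subst Tab (sym W≡) (·-Tab (P i) (·-Tab Tᵢ tQ))

  corner≡ : left bᵢ (take aᵢ W) ≡ Tᵢ
  corner≡ = trans (cong (left bᵢ ∘ take aᵢ) W≡) (proj₂ (proj₂ canon))

  normalise : ∀ {Q~ P~} → Tab Q~ → Tab P~ → Z-part W aᵢ bᵢ ≡ Q~ · P~ →
    ∀ {Q′ P′} → Q′ i ≡ Q₀-part W aᵢ bᵢ · Q~ → P′ i ≡ P~ · P₀-part W aᵢ bᵢ → Q′ ≗[ i ] Q → P′ ≗[ i ] P →
    Links m (FS m (up T)) Q′ P′
  normalise {Q~} {P~} tQ~ tP~ Z≡ {Q′} {P′} q p qs ps = move-right R d L₂ i≤m tail₃ q (trans p (cong (P~ ·_) (sym P₂≡)))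
      (λ k ne → trans (qs k ne) (sym (off k ne))) (λ k ne → trans (ps k ne) (sym (off′ k ne)))
    where
    Q₁ = update i A Q
    P₁ = update i (D · P i) P
    Q₂ = update i (A · drop aᵢ (D · P i)) Q₁
    P₂ = update i (take aᵢ (D · P i)) P₁
    off : ∀ k → k ≢ i → Q₂ k ≡ Q k
    off k ne = trans (update-off i _ Q₁ k ne) (update-off i _ Q k ne)
    off′ : ∀ k → k ≢ i → P₂ k ≡ P k
    off′ k ne = trans (update-off i _ P₁ k ne) (update-off i _ P k ne)
    Q₂≡ : Q₂ i ≡ drop aᵢ W
    Q₂≡ = trans (update-at i _ Q₁) (sym (trans (cong (drop aᵢ) W≡) (proj₁ canon)))
    P₂≡ : P₂ i ≡ P₀-part W aᵢ bᵢ
    P₂≡ = trans (update-at i _ P₁) (trans (proj₁ (proj₂ canon)) (cong (right bᵢ ∘ take aᵢ) (sym W≡)))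
    tail₁ : RightTail bᵢ (Q i) A D
    tail₁ = record { rest = [] ; rest-tab = [] ; X-tab = tD ; Y≡ = refl ; right≡ = sym (·-identityˡ tD) }
    L₁ : Links m (FS m (up T)) Q₁ P₁
    L₁ = move-right R d L i≤m tail₁ (update-at i _ Q) (update-at i _ P) (update-off i _ Q) (update-off i _ P)
    tail₂ : LeftTail aᵢ (P₁ i) (drop aᵢ (D · P i)) (take aᵢ (D · P i))
    tail₂ rewrite update-at i (D · P i) P = record
      { rest = [] ; rest-tab = [] ; X-tab = drop-Tab aᵢ tDP ; Y≡ = sym (·-identityˡ (take-Tab aᵢ tDP)) ; drop≡ = refl }
    L₂ : Links m (FS m (up T)) Q₂ P₂
    L₂ = move-left R′ d L₁ i≤m tail₂
      (trans (update-at i _ Q₁) (cong (_· drop aᵢ (D · P i)) (sym (update-at i A Q))))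
      (update-at i _ P₁) (update-off i _ Q₁) (update-off i _ P₁)
    -- `Q₂ i` is `drop aᵢ W`, whose columns beyond `bᵢ` are by definition the Z-part, so the given
    -- factorization of the Z-part is itself a tail.
    tail₃ : RightTail bᵢ (Q₂ i) (Q₀-part W aᵢ bᵢ · Q~) P~
    tail₃ rewrite Q₂≡ = record { rest = Q~ ; rest-tab = tQ~ ; X-tab = tP~ ; Y≡ = refl ; right≡ = Z≡ }

-- Normalise with the whole Z-part in the right factor, which becomes `right bᵢ w` and ends in `X`.
-- Reassociating hands `X` to the next left factor and leaves the inner sequence unchanged. At the
-- last index the normalised right factor is empty, and so is `X`.
right-step : ∀ {m} → RightTransfer m → LeftTransfer m → RightTransfer (suc m)
right-step {m} R R′ {a} {b} {T} {W} d (Q , P , L , f) {i} {c} {Y} {X} (s≤s i≤m) b≤c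
  record { rest = B ; rest-tab = tB ; X-tab = tX ; Y≡ = Y≡ ; right≡ = right≡ } {W′} atᵢ at₊ off =
  (Q₂ , P₂ , L₂ , f₂) , λ e → proj₂ (emptyB (ℕ.suc-injective e))
  where
  open ≡-Reasoning
  aᵢ = a i (suc i)
  bᵢ = b i (suc i)
  Tᵢ = T i (suc i)
  w  = W i
  tw : Tab w
  tw = W-Tab R R′ d L i i≤m (f i i≤m)
  q₀ = Q₀-part w aᵢ bᵢ
  p₁ = right bᵢ (left c w)
  tq₀ : Tab q₀
  tq₀ = left-Tab bᵢ (drop-Tab aᵢ tw)
  tp₁ : Tab p₁
  tp₁ = right-Tab bᵢ (left-Tab c tw)
  p≡ : Z-part w aᵢ bᵢ · P₀-part w aᵢ bᵢ ≡ p₁ · B · X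
  p≡ = begin
    Z-part w aᵢ bᵢ · P₀-part w aᵢ bᵢ  ≡⟨ right-stack aᵢ bᵢ tw ⟩
    right bᵢ w                        ≡⟨ right-right b≤c tw ⟨
    p₁ · right c w                    ≡⟨ cong (p₁ ·_) right≡ ⟩
    p₁ · (B · X)                      ≡⟨ ·-assoc X tp₁ tB ⟨
    p₁ · B · X                        ∎
  Y≡′ : Y ≡ q₀ · Tᵢ · (p₁ · B)
  Y≡′ = begin
    Y                                       ≡⟨ Y≡ ⟩
    left c w · B                            ≡⟨ cong (_· B) (left-·-right bᵢ (left-Tab c tw)) ⟨
    left bᵢ (left c w) · p₁ · B             ≡⟨ cong (λ V → V · p₁ · B) (left-left b≤c tw) ⟩
    left bᵢ w · p₁ · B                      ≡⟨ cong (λ V → V · p₁ · B) (left-stack aᵢ bᵢ tw) ⟨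
    q₀ · left bᵢ (take aᵢ w) · p₁ · B       ≡⟨ cong (λ V → q₀ · V · p₁ · B) (corner≡ R R′ d L i i≤m (f i i≤m)) ⟩
    q₀ · Tᵢ · p₁ · B                        ≡⟨ ·-assoc B (·-Tab Tᵢ tq₀) tp₁ ⟩
    q₀ · Tᵢ · (p₁ · B)                      ∎
  Q₁ = update i q₀ Q
  P₁ = update i (p₁ · B · X) P
  L₁ : Links m (FS m (up T)) Q₁ P₁
  L₁ = normalise R R′ d L i i≤m (f i i≤m) [] (right-Tab bᵢ (drop-Tab aᵢ tw))
    (sym (·-identityˡ (right-Tab bᵢ (drop-Tab aᵢ tw))))
    (update-at i _ Q) (trans (update-at i _ P) (sym p≡)) (update-off i _ Q) (update-off i _ P)
  Q₂ = update (suc i) (X · Q (suc i)) Q₁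
  P₂ = update i (p₁ · B) P
  tPB : Tab (p₁ · B)
  tPB = ·-Tab B tp₁
  emptyB : i ≡ m → p₁ · B ≡ [] × X ≡ []
  emptyB refl = ·-conical tPB tX (trans (sym (update-at i _ P)) (last L₁))
  P₂-last : Dec (i ≡ m) → P₂ m ≡ []
  P₂-last (yes refl) = trans (update-at i _ P) (proj₁ (emptyB refl))
  P₂-last (no ne)    = trans (update-off i _ P m (ne ∘ sym)) (last L)
  tabs₂ : ∀ k → k ≤ m → Tab (Q₂ k) × Tab (P₂ k)
  tabs₂ k k≤m = tQ₂ , tP₂
    where
    tQ₂ : Tab (Q₂ k)
    tQ₂ with k ℕ.≟ suc i
    ... | yes refl = ·-Tab (Q (suc i)) tX
    ... | no _     = proj₁ (tabs L₁ k k≤m)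
    tP₂ : Tab (P₂ k)
    tP₂ with k ℕ.≟ i
    ... | yes _ = tPB
    ... | no _  = proj₂ (tabs L k k≤m)
  inner₂ : ∀ k → P₁ k · Q₁ (suc k) ≡ P₂ k · Q₂ (suc k)
  inner₂ k with k ℕ.≟ i
  ... | no ne = cong (P k ·_) (sym (update-off (suc i) _ Q₁ (suc k) (ne ∘ ℕ.suc-injective)))
  ... | yes refl = begin
    p₁ · B · X · Q₁ (suc i)     ≡⟨ cong (p₁ · B · X ·_) (update-off i q₀ Q (suc i) (ℕ.>⇒≢ ℕ.≤-refl)) ⟩
    p₁ · B · X · Q (suc i)      ≡⟨ ·-assoc (Q (suc i)) tPB tX ⟩
    p₁ · B · (X · Q (suc i))    ≡⟨ cong (p₁ · B ·_) (update-at (suc i) _ Q₁) ⟨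
    p₁ · B · Q₂ (suc i)         ∎
  L₂ : Links m (FS m (up T)) Q₂ P₂
  L₂ = record
    { first = trans (update-off (suc i) (X · Q (suc i)) Q₁ 0 (λ ())) (first L₁)
    ; last  = P₂-last (i ℕ.≟ m)
    ; tabs  = tabs₂
    ; inner = FS-cong m (λ k _ → inner₂ k) (inner L₁)
    }
  f₂ : Factored m T W′ Q₂ P₂
  f₂ k k≤m with k ℕ.≟ i
  ... | yes refl = trans atᵢ (trans Y≡′ (cong (λ V → V · Tᵢ · (p₁ · B))
    (sym (trans (update-off (suc i) _ Q₁ i (ℕ.<⇒≢ ℕ.≤-refl)) (update-at i q₀ Q)))))
  ... | no k≢i = W′≡ (k ℕ.≟ suc i)
    where
    W′≡ : Dec (k ≡ suc i) → W′ k ≡ Q₂ k · T k (suc k) · P k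
    W′≡ (no k≢1+i) = trans (off k k≢i k≢1+i) (trans (f k k≤m) (cong (λ V → V · T k (suc k) · P k)
      (sym (trans (update-off (suc i) _ Q₁ k k≢1+i) (update-off i q₀ Q k k≢i)))))
    W′≡ (yes refl) = begin
      W′ k                                   ≡⟨ at₊ ⟩
      X · W k                                ≡⟨ cong (X ·_) (f k k≤m) ⟩
      X · (Q k · T k (suc k) · P k)          ≡⟨ ·-assoc (P k) tX (·-Tab (T k (suc k)) tQ₊) ⟨
      X · (Q k · T k (suc k)) · P k          ≡⟨ cong (_· P k) (·-assoc (T k (suc k)) tX tQ₊) ⟨
      X · Q k · T k (suc k) · P k            ≡⟨ cong (λ V → V · T k (suc k) · P k) (update-at k _ Q₁) ⟨
      Q₂ k · T k (suc k) · P k               ∎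
      where tQ₊ = proj₁ (tabs L k k≤m)

-- Here the whole Z-part goes into the left factor, which becomes `drop aᵢ w` and begins with `X`.
left-step : ∀ {m} → RightTransfer m → LeftTransfer m → LeftTransfer (suc m)
left-step {m} R R′ {a} {b} {T} {W} d (Q , P , L , f) {i} {c} {X} {Y} (s≤s i≤m) a≤c
  record { rest = B ; rest-tab = tB ; X-tab = tX ; Y≡ = Y≡ ; drop≡ = drop≡ } {W′} atᵢ before off =
  (Q₂ , P₂ , L₂ , f₂) , λ e → proj₁ (emptyX e)
  where
  open ≡-Reasoning
  aᵢ = a i (suc i)
  bᵢ = b i (suc i)
  Tᵢ = T i (suc i)
  w  = W i
  tw : Tab w
  tw = W-Tab R R′ d L i i≤m (f i i≤m)
  p₀ = P₀-part w aᵢ bᵢ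
  q₁ = drop aᵢ (take c w)
  tp₀ : Tab p₀
  tp₀ = right-Tab bᵢ (take-Tab aᵢ tw)
  tq₁ : Tab q₁
  tq₁ = drop-Tab aᵢ (take-Tab c tw)
  q≡ : Q₀-part w aᵢ bᵢ · Z-part w aᵢ bᵢ ≡ X · (B · q₁)
  q≡ = begin
    Q₀-part w aᵢ bᵢ · Z-part w aᵢ bᵢ  ≡⟨ left-·-right bᵢ (drop-Tab aᵢ tw) ⟩
    drop aᵢ w                         ≡⟨ drop-drop-take w a≤c tw ⟨
    drop c w · q₁                     ≡⟨ cong (_· q₁) drop≡ ⟩
    X · B · q₁                        ≡⟨ ·-assoc q₁ tX tB ⟩
    X · (B · q₁)                      ∎
  tBq : Tab (B · q₁)
  tBq = ·-Tab q₁ tB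
  Y≡′ : Y ≡ B · q₁ · Tᵢ · p₀
  Y≡′ = begin
    Y                                      ≡⟨ Y≡ ⟩
    B · take c w                           ≡⟨ cong (B ·_) (drop-·-take aᵢ (take-Tab c tw)) ⟨
    B · (q₁ · take aᵢ (take c w))          ≡⟨ cong (λ V → B · (q₁ · V)) (trans (List.take-take aᵢ c w) (cong (λ k → take k w) (ℕ.m≤n⇒m⊓n≡m a≤c))) ⟩
    B · (q₁ · take aᵢ w)                   ≡⟨ ·-assoc (take aᵢ w) tB tq₁ ⟨
    B · q₁ · take aᵢ w                     ≡⟨ cong (B · q₁ ·_) (left-·-right bᵢ (take-Tab aᵢ tw)) ⟨
    B · q₁ · (left bᵢ (take aᵢ w) · p₀)    ≡⟨ cong (λ V → B · q₁ · (V · p₀)) (corner≡ R R′ d L i i≤m (f i i≤m)) ⟩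
    B · q₁ · (Tᵢ · p₀)                     ≡⟨ ·-assoc p₀ tBq (tab (corner d ℕ.≤-refl (s≤s i≤m))) ⟨
    B · q₁ · Tᵢ · p₀                       ∎
  Q₁ = update i (X · (B · q₁)) Q
  P₁ = update i p₀ P
  L₁ : Links m (FS m (up T)) Q₁ P₁
  L₁ = normalise R R′ d L i i≤m (f i i≤m) (right-Tab bᵢ (drop-Tab aᵢ tw)) [] refl
    (trans (update-at i _ Q) (sym q≡)) (trans (update-at i _ P) (sym (·-identityˡ tp₀))) (update-off i _ Q) (update-off i _ P)
  emptyX : i ≡ 0 → X ≡ [] × B · q₁ ≡ []
  emptyX refl = ·-conical tX tBq (trans (sym (update-at 0 _ Q)) (first L₁))
  -- The factor that receives `X` has index `i - 1`, which need not exist; deciding `suc k ≡ i`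
  -- selects it, and for `i = 0` selects nothing.
  shifted : ∀ k → Dec (suc k ≡ i) → Tableau
  shifted k (yes _) = P k · X
  shifted k (no _)  = P₁ k
  Q₂ = update i (B · q₁) Q
  P₂ : ℕ → Tableau
  P₂ k = shifted k (suc k ℕ.≟ i)
  Q₂-first : Dec (0 ≡ i) → Q₂ 0 ≡ []
  Q₂-first (yes refl) = trans (update-at 0 _ Q) (proj₂ (emptyX refl))
  Q₂-first (no ne)    = trans (update-off i _ Q 0 ne) (first L)
  P₂-last : (e? : Dec (suc m ≡ i)) → shifted m e? ≡ []
  P₂-last (yes refl) = contradiction i≤m ℕ.1+n≰n
  P₂-last (no _)     = last L₁
  tabs₂ : ∀ k → k ≤ m → Tab (Q₂ k) × Tab (P₂ k)
  tabs₂ k k≤m = tQ₂ (k ℕ.≟ i) , tP₂ (suc k ℕ.≟ i)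
    where
    tQ₂ : Dec (k ≡ i) → Tab (Q₂ k)
    tQ₂ (yes refl) = subst Tab (sym (update-at i _ Q)) tBq
    tQ₂ (no ne)    = subst Tab (sym (update-off i _ Q k ne)) (proj₁ (tabs L k k≤m))
    tP₂ : (e? : Dec (suc k ≡ i)) → Tab (shifted k e?)
    tP₂ (yes _) = ·-Tab X (proj₂ (tabs L k k≤m))
    tP₂ (no _)  = proj₂ (tabs L₁ k k≤m)
  inner₂ : ∀ k → k < m → P₁ k · Q₁ (suc k) ≡ P₂ k · Q₂ (suc k)
  inner₂ k k<m with suc k ℕ.≟ i
  ... | no _ = refl
  ... | yes refl = trans (cong (_· (X · (B · q₁))) (update-off i p₀ P k (ℕ.<⇒≢ ℕ.≤-refl)))
    (sym (·-assoc (B · q₁) (proj₂ (tabs L k (ℕ.<⇒≤ k<m))) tX))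
  L₂ : Links m (FS m (up T)) Q₂ P₂
  L₂ = record
    { first = Q₂-first (0 ℕ.≟ i)
    ; last  = P₂-last (suc m ℕ.≟ i)
    ; tabs  = tabs₂
    ; inner = FS-cong m inner₂ (inner L₁)
    }
  f₂ : Factored m T W′ Q₂ P₂
  f₂ k k≤m with k ℕ.≟ i | suc k ℕ.≟ i
  ... | yes refl | yes ()
  ... | yes refl | no _  = trans atᵢ (trans Y≡′ (cong (B · q₁ · Tᵢ ·_) (sym (update-at i p₀ P))))
  ... | no k≢i   | no ne = trans (off k k≢i ne) (trans (f k k≤m) (cong (Q k · T k (suc k) ·_) (sym (update-off i p₀ P k k≢i))))
  ... | no _     | yes refl = trans (before k refl) (trans (cong (_· X) (f k k≤m))
    (·-assoc X (·-Tab (T k (suc k)) (proj₁ (tabs L k k≤m))) (proj₂ (tabs L k k≤m))))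

transfer : ∀ m → RightTransfer m × LeftTransfer m
transfer zero    = (λ _ _ ()) , (λ _ _ ())
transfer (suc m) = let R , R′ = transfer m in right-step R R′ , left-step R R′

-- Reaching the given simple factorizations

Simple : ℕ → (ℕ → ℕ → ℕ) → (ℕ → ℕ → ℕ) → Array → (W Q P : ℕ → Tableau) → Set
Simple m a b T W Q P = ∀ i → i ≤ m →
  SimpleFactorization (W i) (a i (suc i)) (b i (suc i)) (T i (suc i)) (Q i) (P i)

-- Factors are replaced one index at a time. `normalise` at `j` leaves all other indices alone, so
-- the agreement below `j` persists.
Agreeing : ℕ → ℕ → Array → (W Q P : ℕ → Tableau) → Set
Agreeing m j T W Q P = ∃₂ λ Q′ P′ → Links m (FS m (up T)) Q′ P′ × Factored m T W Q′ P′ ×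
  (∀ k → k < j → Q′ k ≡ Q k × P′ k ≡ P k)

agree-at : ∀ {m a b T W Q P} → Diagram (suc m) a b T → ∀ j → j ≤ m →
  SimpleFactorization (W j) (a j (suc j)) (b j (suc j)) (T j (suc j)) (Q j) (P j) →
  Agreeing m j T W Q P → Agreeing m (suc j) T W Q P
agree-at {m} {T = T} {W} {Q} {P} d j j≤m (_ , _ , W≡ , Q~ , P~ , tQ~ , tP~ , Z≡ , q , p) (Q₁ , P₁ , L , f , agree) =
  Q₂ , P₂ ,
  normalise (proj₁ (transfer m)) (proj₂ (transfer m)) d L j j≤m (f j j≤m) (IsTableau⇒Tab tQ~) (IsTableau⇒Tab tP~) Z≡
    (trans (update-at j _ Q₁) q) (trans (update-at j _ P₁) p) (update-off j _ Q₁) (update-off j _ P₁) ,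
  f₂ , agree₂
  where
  Q₂ = update j (Q j) Q₁
  P₂ = update j (P j) P₁
  f₂ : Factored m T W Q₂ P₂
  f₂ k k≤m with k ℕ.≟ j
  ... | yes refl = W≡
  ... | no _     = f k k≤m
  agree₂ : ∀ k → k < suc j → Q₂ k ≡ Q k × P₂ k ≡ P k
  agree₂ k (s≤s k≤j) with k ℕ.≟ j
  ... | yes refl = refl , refl
  ... | no ne    = agree k (ℕ.≤∧≢⇒< k≤j ne)

simple-agree : ∀ {m a b T W Q P} → Diagram (suc m) a b T → Simple m a b T W Q P →
  FS (suc m) T W → ∀ j → j ≤ suc m → Agreeing m j T W Q P
simple-agree d s (Q , P , L , f) zero    _         = Q , P , L , f , λ _ ()
simple-agree d s fs              (suc j) (s≤s j≤m) =
  agree-at d j j≤m (s j j≤m) (simple-agree d s fs j (ℕ.m≤n⇒m≤1+n j≤m))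

simple-links : ∀ {m a b T W Q P} → Diagram (suc m) a b T → Simple m a b T W Q P →
  FS (suc m) T W → Links m (FS m (up T)) Q P
simple-links {m} d s fs =
  let _ , _ , L , _ , agree = simple-agree d s fs (suc m) ℕ.≤-refl
  in Links-cong m (λ k k≤m → agree k (s≤s k≤m)) L

-- Translation between the two forms of factor sequences

FactorSeq⇒FS : ∀ m {a b T W} → Diagram (suc m) a b T → FactorSeq (suc m) T W → FS (suc m) T (W ∘ suc)
FactorSeq⇒FS zero {T = T} d e = (λ _ → []) , (λ _ → []) ,
  record { first = refl ; last = refl ; tabs = λ _ _ → [] , [] ; inner = tt } ,
  λ { zero _ → trans e (sym (·-identityˡ (tab (corner d ℕ.≤-refl ℕ.≤-refl)))) }
FactorSeq⇒FS (suc m) {T = T} {W} d (U , P , Q , fs , U≡ , W-first , W-mid , W-last) =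
  Q′ , P′ , record
    { first = refl
    ; last  = update-at (suc m) [] (P ∘ suc)
    ; tabs  = λ i i≤ → tQ i i≤ , tP i i≤
    ; inner = FS-cong (suc m) {T = up T} (λ i i< → trans (proj₂ (proj₂ (U≡ (suc i) (s≤s z≤n) i<))) (cong (_· Q (suc i)) (sym (P′≡ i i<))))
        (FactorSeq⇒FS m {T = up T} (Diagram-up d) fs)
    } , f
  where
  -- The witnesses of `FactorSeq` are arbitrary at the two outer positions; both are reset to the
  -- empty tableau.
  Q′ P′ : ℕ → Tableau
  Q′ zero    = []
  Q′ (suc i) = Q (suc i)
  P′ = update (suc m) [] (P ∘ suc)
  P′≡ : ∀ i → i < suc m → P′ i ≡ P (suc i)
  P′≡ i i< = update-off (suc m) [] (P ∘ suc) i (ℕ.<⇒≢ i<)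
  tQ : ∀ i → i ≤ suc m → Tab (Q′ i)
  tQ zero    _  = []
  tQ (suc i) i< = IsTableau⇒Tab (proj₁ (proj₂ (U≡ (suc i) (s≤s z≤n) i<)))
  tP : ∀ i → i ≤ suc m → Tab (P′ i)
  tP i i≤ with i ℕ.≟ suc m
  ... | yes _ = []
  ... | no ne = IsTableau⇒Tab (proj₁ (U≡ (suc i) (s≤s z≤n) (ℕ.≤∧≢⇒< i≤ ne)))
  f : Factored (suc m) T (W ∘ suc) Q′ P′
  f i i≤ with i ℕ.≟ suc m
  ... | yes refl = W-last
  f zero    _  | no ne = trans W-first (cong (_· P 1) (sym (·-identityˡ (tab (corner d ℕ.≤-refl (s≤s z≤n))))))
  f (suc i) i≤ | no ne = W-mid (suc (suc i)) (s≤s (s≤s z≤n)) (ℕ.≤∧≢⇒< i≤ ne)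

FS⇒FactorSeq : ∀ m {a b T W} → Diagram (suc m) a b T → FS (suc m) T (W ∘ suc) → FactorSeq (suc m) T W
FS⇒FactorSeq zero {T = T} d (Q , P , L , f) = trans (f 0 z≤n)
  (trans (cong₂ (λ X Y → X · T 0 1 · Y) (first L) (last L)) (·-identityˡ (tab (corner d ℕ.≤-refl ℕ.≤-refl))))
FS⇒FactorSeq (suc m) {T = T} d (Q , P , L , f) =
  (λ i → P (i ∸ 1) · Q i) , (λ i → P (i ∸ 1)) , Q , FS⇒FactorSeq m {T = up T} (Diagram-up d) (inner L) ,
  (λ { (suc i) _ i< → Tab⇒IsTableau (proj₂ (tabs L i (ℕ.<⇒≤ i<))) , Tab⇒IsTableau (proj₁ (tabs L (suc i) i<)) , refl }) ,
  trans (f 0 z≤n) (cong (_· P 0) (trans (cong (_· T 0 1) (first L)) (·-identityˡ (tab (corner d ℕ.≤-refl (s≤s z≤n)))))) ,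
  (λ { (suc i) _ i< → f i (ℕ.<⇒≤ i<) }) ,
  trans (f (suc m) ℕ.≤-refl) (cong (Q (suc m) · T (suc m) (suc (suc m)) ·_) (last L))

-- The second-difference inequality compares neighbouring first differences, in one direction for
-- `a` and in the other for `b`. The assumption `s ≤ v` makes the right-hand subtraction exact.
∸-mono-diff : ∀ {s t x v} → s ℕ.+ t ≤ x ℕ.+ v → s ≤ v → t ∸ x ≤ v ∸ s
∸-mono-diff {s} {t} {x} {v} p q = ℕ.m≤n+o⇒m∸n≤o t x (ℕ.+-cancelˡ-≤ s t (x ℕ.+ (v ∸ s)) (begin
  s ℕ.+ t               ≤⟨ p ⟩
  x ℕ.+ v               ≡⟨ cong (x ℕ.+_) (ℕ.m+[n∸m]≡n q) ⟨
  x ℕ.+ (s ℕ.+ (v ∸ s)) ≡⟨ ℕ.+-assoc x s (v ∸ s) ⟨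
  x ℕ.+ s ℕ.+ (v ∸ s)   ≡⟨ cong (ℕ._+ (v ∸ s)) (ℕ.+-comm x s) ⟩
  s ℕ.+ x ℕ.+ (v ∸ s)   ≡⟨ ℕ.+-assoc s x (v ∸ s) ⟩
  s ℕ.+ (x ℕ.+ (v ∸ s)) ∎))
  where open ℕ.≤-Reasoning

diagram : ∀ {n r T} → RankConditions n r → TableauDiagram n r T → Diagram n (aR r) (bR r) T
diagram {n} {r} (mono , quad) (shapes , larger) = record
  { corner = λ {i} {j} p q → shape⇒Corner (aR r i j) (bR r i j) (IsTableau⇒Tab (proj₁ (shapes i j p q))) (proj₂ (shapes i j p q))
  ; a-mono = λ {i} {j} p q → ∸-mono-diff (quad i (suc j) (s≤s p) q) (proj₂ (mono i j p (ℕ.<⇒≤ q)))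
  ; b-mono = λ {i} {j} p q → ∸-mono-diff
      (subst (_≤ r i j ℕ.+ r (suc i) (j ∸ 1)) (ℕ.+-comm (r i (j ∸ 1)) (r (suc i) j)) (quad i j p q))
      (proj₁ (mono (suc i) j p q))
  ; order  = λ {i} {j} {k} {l} p q s t u ne →
      All.tabulate (λ y∈ → All.tabulate (λ x∈ → larger i j k l p q s t u ne _ _ x∈ y∈))
  }

theorem3 : (n : ℕ) → 2 ≤ n → (r : ℕ → ℕ → ℕ) → RankConditions n r →
    (T : ℕ → ℕ → Tableau) → TableauDiagram n r T →
    (W : ℕ → Tableau) →
    (∀ i → 1 ≤ i → i ≤ n → IsTableau (W i)) →
    (∀ i → 1 ≤ i → i ≤ n →
    ContainsUL (W i) (aR r (i ∸ 1) i) (bR r (i ∸ 1) i) (T (i ∸ 1) i)) →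
    (Q P : ℕ → Tableau) →
    (∀ i → 1 ≤ i → i ≤ n →
    SimpleFactorization (W i) (aR r (i ∸ 1) i) (bR r (i ∸ 1) i)
    (T (i ∸ 1) i) (Q (i ∸ 1)) (P i)) →
    (FactorSeq n T W
    ⇔ ((Q 0 ≡ []) × (P n ≡ [])
    × FactorSeq (n ∸ 1) (λ i j → T i (suc j)) (λ i → P i · Q i)))
theorem3 (suc (suc m)) (s≤s (s≤s _)) r rank T diag W _ _ Q P simple = mk⇔ to from
  where
  d : Diagram (suc (suc m)) (aR r) (bR r) T
  d = diagram rank diag
  to : FactorSeq (suc (suc m)) T W →
    Q 0 ≡ [] × P (suc (suc m)) ≡ [] × FactorSeq (suc m) (up T) (λ i → P i · Q i)
  to fs = first L , last L , FS⇒FactorSeq m {T = up T} (Diagram-up d) (inner L)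
    where
    L : Links (suc m) (FS (suc m) (up T)) Q (P ∘ suc)
    L = simple-links {a = aR r} {bR r} {T} {W ∘ suc} {Q} {P ∘ suc} d
      (λ i i≤ → simple (suc i) (s≤s z≤n) (s≤s i≤)) (FactorSeq⇒FS (suc m) {T = T} {W} d fs)
  W≡ : ∀ i → i ≤ suc m → W (suc i) ≡ Q i · T i (suc i) · P (suc i)
  W≡ i i≤ = proj₁ (proj₂ (proj₂ (simple (suc i) (s≤s z≤n) (s≤s i≤))))
  from : Q 0 ≡ [] × P (suc (suc m)) ≡ [] × FactorSeq (suc m) (up T) (λ i → P i · Q i) →
    FactorSeq (suc (suc m)) T W
  from (Q≡ , P≡ , fs) = (λ i → P i · Q i) , P , Q , fs ,
    (λ { (suc i) _ i≤ → proj₁ (proj₂ (simple (suc i) (s≤s z≤n) (ℕ.m≤n⇒m≤1+n i≤))) ,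
                        proj₁ (simple (suc (suc i)) (s≤s z≤n) (s≤s i≤)) , refl }) ,
    trans (W≡ 0 z≤n) (cong (_· P 1) (trans (cong (_· T 0 1) Q≡) (·-identityˡ (tab (corner d ℕ.≤-refl (s≤s z≤n)))))) ,
    (λ { (suc i) _ i≤ → W≡ i (ℕ.<⇒≤ i≤) }) ,
    trans (W≡ (suc m) ℕ.≤-refl) (cong (Q (suc m) · T (suc m) (suc (suc m)) ·_) P≡)
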